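{- Let $G$ be a strongly connected network on node set $\mathcal{V}=\{1,\dots,n\}$ with random-walk transition matrix $P$, stationary distribution $\pi$ (so $\pi_i>0$ for all $i$) and $\Pi=\mathrm{diag}(\pi_1,\dots,\pi_n)$. Let $L=\Pi(I-P)$ (digraph Laplacian) and $L^p=I-P$ (random walk Laplacian), and let $L^+$, ${L^p}^+$ denote their Moore–Penrose pseudo-inverses. Then for all $s,m,t\in\mathcal{V}$ the fundamental tensor satisfies $$\boldsymbol{F}_{smt}=(L^+_{sm}-L^+_{tm}+L^+_{tt}-L^+_{st})\,\pi_m$$ and $$\boldsymbol{F}_{smt}={L^p}^+_{sm}-{L^p}^+_{tm}+\frac{\pi_m}{\pi_t}{L^p}^+_{tt}-\frac{\pi_m}{\pi_t}{L^p}^+_{st}.$$ Consequently the whole tensor $\boldsymbol{F}$ can be computed with $O(n^3)$ time complexity.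
   Context: A network is a weighted directed graph $G=(\mathcal{V},\mathcal{E})$ with nonnegative affinity matrix $A=[a_{ij}]$, $a_{ij}>0$ iff $(i,j)\in\mathcal{E}$; $D=\mathrm{diag}(d_i)$ with $d_i=\sum_j a_{ij}$, and the random walk has transition matrix $P=D^{ -1}A$. Strongly connected means every node is reachable from every other node. For a nonempty set of target nodes $\mathcal{A}\subsetneq\mathcal{V}$ with $\mathcal{T}=\mathcal{V}\setminus\mathcal{A}$, the fundamental matrix is $F^{\mathcal{A}}=(I-P_{\mathcal{T}\mathcal{T}})^{ -1}$, indexed by $\mathcal{T}\times\mathcal{T}$, where $P_{\mathcal{T}\mathcal{T}}$ is the submatrix of $P$ on rows and columns $\mathcal{T}$; $F^{\mathcal{A}}_{sm}$ is the expected number of visits to $m$ by the walk started at $s$ before first hitting $\mathcal{A}$. Write $F^{\{t\}}$ for a single target $t$. The fundamental tensor is $\boldsymbol{F}_{smt}=F^{\{t\}}_{sm}$ if $s,m\neq t$, and $\boldsymbol{F}_{smt}=0$ if $s=t$ or $m=t$. -}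

module Defs where

open import Level using (_⊔_; Lift) renaming (suc to lsuc)
open import Algebra.Bundles using (CommutativeRing)
open import Data.Bool.Base using (Bool; true; false; _∧_; if_then_else_)
open import Data.Fin.Base as Fin using (Fin)
open import Data.Fin.Properties as Fin using ()
open import Data.Fin.Subset using (Subset; _∉_; ⁅_⁆)
open import Data.Fin.Subset.Properties using (_∈?_)
open import Data.List.Base as List using (List; []; _∷_; length; allFin)
open import Data.List.Properties using (≡-dec)
open import Data.Nat.Base as ℕ using (ℕ; suc)
import Data.Nat.Properties as ℕ
open import Data.Product.Base using (Σ; ∃₂; ∃-syntax; _×_; _,_)
open import Data.Unit.Base using (⊤)
open import Data.Vec.Base as Vec using (Vec; []; _∷_; lookup)
open import Relation.Binary.Core using (Rel)
open import Relation.Binary.Definitions using (DecidableEquality)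
open import Relation.Binary.PropositionalEquality.Core using (_≡_; refl)
open import Relation.Binary.Structures using (IsStrictTotalOrder)
open import Relation.Binary.Construct.Closure.ReflexiveTransitive using (Star)
open import Relation.Nullary using (¬_; yes; no; does)
import Algebra.Properties.Semiring.Sum as SemiringSum
import Relation.Binary.Construct.StrictToNonStrict as StrictToNonStrict

-- Ordered fields (with decidable order) stand in for ℝ.  The inverse is total, but
-- its value at 0# is left unspecified.
record OrderedField c ℓ₁ ℓ₂ : Set (lsuc (c ⊔ ℓ₁ ⊔ ℓ₂)) where
  infix  4 _<_
  infixl 7 _/_
  infix  9 _⁻¹

  field
    commutativeRing : CommutativeRing c ℓ₁

  open CommutativeRing commutativeRing public

  field
    _<_                : Rel Carrier ℓ₂
    isStrictTotalOrder : IsStrictTotalOrder _≈_ _<_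
    0≉1                : ¬ 0# ≈ 1#
    +-monoˡ-<          : ∀ {x y} z → x < y → x + z < y + z
    *-pos              : ∀ {x y} → 0# < x → 0# < y → 0# < x * y
    _⁻¹                : Carrier → Carrier
    ⁻¹-inverseʳ        : ∀ {x} → ¬ x ≈ 0# → x * x ⁻¹ ≈ 1#

  _/_ : Carrier → Carrier → Carrier
  x / y = x * y ⁻¹

  open StrictToNonStrict _≈_ _<_ public using (_≤_)
  open SemiringSum semiring public using (sum)

-- I is a finite type and ∑ is summation over it.
module SquareMatrices {c ℓ₁ ℓ₂} (K : OrderedField c ℓ₁ ℓ₂)
  {I : Set} (_≟_ : DecidableEquality I)
  (∑ : (I → OrderedField.Carrier K) → OrderedField.Carrier K)
  where

  open OrderedField K using (Carrier; _≈_; 0#; 1#) renaming (_*_ to _*ₖ_; _-_ to _-ₖ_)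

  infix  4 _≈ᴹ_
  infixl 6 _-ᴹ_
  infixl 7 _*ᴹ_
  infix  8 _ᵀ

  Matrix : Set c
  Matrix = I → I → Carrier

  _≈ᴹ_ : Matrix → Matrix → Set ℓ₁
  M ≈ᴹ N = ∀ i j → M i j ≈ N i j

  diag : (I → Carrier) → Matrix
  diag d i j = if does (i ≟ j) then d i else 0#

  1ᴹ : Matrix
  1ᴹ = diag (λ _ → 1#)

  _-ᴹ_ : Matrix → Matrix → Matrix
  (M -ᴹ N) i j = M i j -ₖ N i j

  _*ᴹ_ : Matrix → Matrix → Matrix
  (M *ᴹ N) i j = ∑ (λ k → M i k *ₖ N k j)

  _ᵀ : Matrix → Matrix
  (M ᵀ) i j = M j i

  IsInverse : Matrix → Matrix → Set ℓ₁
  IsInverse M N = M *ᴹ N ≈ᴹ 1ᴹ × N *ᴹ M ≈ᴹ 1ᴹ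

  -- Penrose's four conditions; the entries are real, so the adjoint is ᵀ.
  record IsMoorePenrose (M X : Matrix) : Set ℓ₁ where
    field
      MXM≈M   : M *ᴹ X *ᴹ M ≈ᴹ M
      XMX≈X   : X *ᴹ M *ᴹ X ≈ᴹ X
      MX-symm : (M *ᴹ X) ᵀ ≈ᴹ M *ᴹ X
      XM-symm : (X *ᴹ M) ᵀ ≈ᴹ X *ᴹ M

module RandomWalks {c ℓ₁ ℓ₂} (K : OrderedField c ℓ₁ ℓ₂) where

  open OrderedField K hiding (refl)

  module _ {n : ℕ} where
    open SquareMatrices K {Fin n} Fin._≟_ sum public

  -- An edge is by definition a pair of positive affinity, so the edge set
  -- is not recorded separately.
  record Network (n : ℕ) : Set (c ⊔ ℓ₁ ⊔ ℓ₂) where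
    field
      affinity : Fin n → Fin n → Carrier
      nonneg   : ∀ i j → 0# ≤ affinity i j

    Edge : Rel (Fin n) ℓ₂
    Edge i j = 0# < affinity i j

    degree : Fin n → Carrier
    degree i = sum (affinity i)

    P : Matrix {n}
    P = diag (λ i → degree i ⁻¹) *ᴹ affinity

  StronglyConnected : ∀ {n} → Network n → Set ℓ₂
  StronglyConnected G = ∀ i j → Star (Network.Edge G) i j

  record IsStationary {n} (G : Network n) (π : Fin n → Carrier) : Set (ℓ₁ ⊔ ℓ₂) where
    open Network G
    field
      nonneg    : ∀ i → 0# ≤ π i
      total     : sum π ≈ 1#
      invariant : ∀ j → sum (λ i → π i * P i j) ≈ π j

  randomWalkLaplacian : ∀ {n} → Network n → Matrix {n}
  randomWalkLaplacian G = 1ᴹ -ᴹ Network.P G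

  digraphLaplacian : ∀ {n} → Network n → (Fin n → Carrier) → Matrix {n}
  digraphLaplacian G π = diag π *ᴹ (1ᴹ -ᴹ Network.P G)

  -- The transient nodes 𝒱 ∖ 𝒜.
  𝒯 : ∀ {n} → Subset n → Set
  𝒯 𝒜 = ∃[ i ] i ∉ 𝒜

  -- Proofs of i ∉ 𝒜 are definitionally equal.
  _≟ᵀ_ : ∀ {n} {𝒜 : Subset n} → DecidableEquality (𝒯 𝒜)
  (i , _) ≟ᵀ (j , _) with i Fin.≟ j
  ... | yes refl = yes refl
  ... | no  i≢j  = no λ { refl → i≢j refl }

  -- Extension by zero.
  extend : ∀ {n} (𝒜 : Subset n) → (𝒯 𝒜 → Carrier) → Fin n → Carrier
  extend 𝒜 f i with i ∈? 𝒜
  ... | yes _   = 0#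
  ... | no  i∉𝒜 = f (i , i∉𝒜)

  sumᵀ : ∀ {n} (𝒜 : Subset n) → (𝒯 𝒜 → Carrier) → Carrier
  sumᵀ 𝒜 f = sum (extend 𝒜 f)

  module Transient {n} (𝒜 : Subset n) =
    SquareMatrices K (_≟ᵀ_ {𝒜 = 𝒜}) (sumᵀ 𝒜)

  principalSubmatrix : ∀ {n} (𝒜 : Subset n) → Matrix {n} → Transient.Matrix 𝒜
  principalSubmatrix 𝒜 M (i , _) (j , _) = M i j

  IsFundamentalMatrix : ∀ {n} → Network n → (𝒜 : Subset n) → Transient.Matrix 𝒜 → Set ℓ₁
  IsFundamentalMatrix G 𝒜 F =
    𝓣.IsInverse (𝓣.1ᴹ 𝓣.-ᴹ principalSubmatrix 𝒜 (Network.P G)) F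
    where module 𝓣 = Transient 𝒜

  Tensor : ℕ → Set c
  Tensor n = Fin n → Fin n → Fin n → Carrier

  tensor : ∀ {n} → (∀ t → Transient.Matrix {n} ⁅ t ⁆) → Tensor n
  tensor F s m t with s ∈? ⁅ t ⁆ | m ∈? ⁅ t ⁆
  ... | no s≢t | no m≢t = F t (s , s≢t) (m , m≢t)
  ... | _      | _      = 0#

  IsFundamentalTensor : ∀ {n} → Network n → Tensor n → Set (c ⊔ ℓ₁)
  IsFundamentalTensor {n} G 𝐅 =
    Σ (∀ t → Transient.Matrix {n} ⁅ t ⁆) λ F →
      (∀ t → IsFundamentalMatrix G ⁅ t ⁆ (F t)) × (∀ s m t → 𝐅 s m t ≈ tensor F s m t)

-- A model of computation with field arithmetic at unit cost.
--
-- One program text serves all input sizes n.  Control flow consists of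
-- loops over the indices 0, …, n − 1 and of tests on loop indices; field
-- elements cannot be inspected.  Every such program runs on a real RAM
-- within a constant factor of the step count below, so upper bounds
-- in this model carry over to that one.
--
-- The number k counts the loop indices in scope, innermost first.  Data
-- are held in arrays named by natural numbers; a cell is addressed by
-- the array name and a list of loop indices.
infixr 5 _⨾_
infix  6 _[_]≔_
infixl 7 _⊕_ _⊖_
infixl 8 _⊗_ _⊘_
infix  9 _[_]

data Exp (k : ℕ) : Set where
  `0 `1               : Exp k
  _[_]                : ℕ → List (Fin k) → Exp k
  _⊕_ _⊖_ _⊗_ _⊘_     : Exp k → Exp k → Exp k

data Test (k : ℕ) : Set where
  isFirst : Fin k → Test k
  same    : Fin k → Fin k → Test k

data Command (k : ℕ) : Set where
  skip         : Command k
  _[_]≔_       : ℕ → List (Fin k) → Exp k → Command k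
  _⨾_          : Command k → Command k → Command k
  branch       : Test k → Command k → Command k → Command k
  for          : Command (suc k) → Command k

Program : Set
Program = Command 0

holds : ∀ {n k} → Test k → Vec (Fin n) k → Bool
holds (isFirst x) ρ = does (Fin.toℕ (lookup ρ x) ℕ.≟ 0)
holds (same x y)  ρ = does (lookup ρ x Fin.≟ lookup ρ y)

steps : ∀ {k} → Exp k → ℕ
steps `0         = 1
steps `1         = 1
steps (_ [ xs ]) = 1 ℕ.+ length xs
steps (d ⊕ e)    = 1 ℕ.+ (steps d ℕ.+ steps e)
steps (d ⊖ e)    = 1 ℕ.+ (steps d ℕ.+ steps e)
steps (d ⊗ e)    = 1 ℕ.+ (steps d ℕ.+ steps e)
steps (d ⊘ e)    = 1 ℕ.+ (steps d ℕ.+ steps e)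

module Execution {c ℓ₁ ℓ₂} (K : OrderedField c ℓ₁ ℓ₂) where

  open OrderedField K

  Memory : ℕ → Set c
  Memory n = ℕ → List (Fin n) → Carrier

  -- The input matrix is array 0; all other cells start out as 0#.
  load : ∀ {n} → (Fin n → Fin n → Carrier) → Memory n
  load a 0 (i ∷ j ∷ []) = a i j
  load a _ _            = 0#

  -- The output is read from array 1.
  output : ∀ {n} → Memory n → Fin n → Fin n → Fin n → Carrier
  output σ i j k = σ 1 (i ∷ j ∷ k ∷ [])

  module _ {n : ℕ} where

    address : ∀ {k} → Vec (Fin n) k → List (Fin k) → List (Fin n)
    address ρ = List.map (lookup ρ)

    write : ℕ → List (Fin n) → Carrier → Memory n → Memory n
    write r is v σ r′ is′ =
      if does (r ℕ.≟ r′) ∧ does (≡-dec Fin._≟_ is is′) then v else σ r′ is′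

    eval : ∀ {k} → Vec (Fin n) k → Memory n → Exp k → Carrier
    eval ρ σ `0         = 0#
    eval ρ σ `1         = 1#
    eval ρ σ (r [ xs ]) = σ r (address ρ xs)
    eval ρ σ (d ⊕ e)    = eval ρ σ d + eval ρ σ e
    eval ρ σ (d ⊖ e)    = eval ρ σ d - eval ρ σ e
    eval ρ σ (d ⊗ e)    = eval ρ σ d * eval ρ σ e
    eval ρ σ (d ⊘ e)    = eval ρ σ d / eval ρ σ e

    -- No denominator is zero.
    Defined : ∀ {k} → Vec (Fin n) k → Memory n → Exp k → Set ℓ₁
    Defined ρ σ `0        = Lift ℓ₁ ⊤
    Defined ρ σ `1        = Lift ℓ₁ ⊤
    Defined ρ σ (_ [ _ ]) = Lift ℓ₁ ⊤
    Defined ρ σ (d ⊕ e)   = Defined ρ σ d × Defined ρ σ e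
    Defined ρ σ (d ⊖ e)   = Defined ρ σ d × Defined ρ σ e
    Defined ρ σ (d ⊗ e)   = Defined ρ σ d × Defined ρ σ e
    Defined ρ σ (d ⊘ e)   = Defined ρ σ d × Defined ρ σ e × ¬ eval ρ σ e ≈ 0#

    infix 4 _⊢⟨_,_⟩⇓[_]_ _⊢⟨for_∈_,_⟩⇓[_]_

    -- ρ ⊢⟨ p , σ ⟩⇓[ τ ] σ′ : with loop indices ρ, running p from memory
    -- σ halts in memory σ′ after τ steps.
    mutual
      data _⊢⟨_,_⟩⇓[_]_ {k} (ρ : Vec (Fin n) k) :
             Command k → Memory n → ℕ → Memory n → Set (c ⊔ ℓ₁) where
        skip   : ∀ {σ} → ρ ⊢⟨ skip , σ ⟩⇓[ 1 ] σ
        assign : ∀ {σ r xs e} → Defined ρ σ e →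
                 ρ ⊢⟨ r [ xs ]≔ e , σ ⟩⇓[ 1 ℕ.+ (length xs ℕ.+ steps e) ]
                   write r (address ρ xs) (eval ρ σ e) σ
        seq    : ∀ {p q σ σ′ σ″ τ τ′} →
                 ρ ⊢⟨ p , σ ⟩⇓[ τ ] σ′ → ρ ⊢⟨ q , σ′ ⟩⇓[ τ′ ] σ″ →
                 ρ ⊢⟨ p ⨾ q , σ ⟩⇓[ 1 ℕ.+ (τ ℕ.+ τ′) ] σ″
        ifᵗ    : ∀ {b p q σ σ′ τ} → holds b ρ ≡ true → ρ ⊢⟨ p , σ ⟩⇓[ τ ] σ′ →
                 ρ ⊢⟨ branch b p q , σ ⟩⇓[ 1 ℕ.+ τ ] σ′
        ifᶠ    : ∀ {b p q σ σ′ τ} → holds b ρ ≡ false → ρ ⊢⟨ q , σ ⟩⇓[ τ ] σ′ →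
                 ρ ⊢⟨ branch b p q , σ ⟩⇓[ 1 ℕ.+ τ ] σ′
        for    : ∀ {p σ σ′ τ} → ρ ⊢⟨for p ∈ allFin n , σ ⟩⇓[ τ ] σ′ →
                 ρ ⊢⟨ for p , σ ⟩⇓[ 1 ℕ.+ τ ] σ′

      data _⊢⟨for_∈_,_⟩⇓[_]_ {k} (ρ : Vec (Fin n) k) (p : Command (suc k)) :
             List (Fin n) → Memory n → ℕ → Memory n → Set (c ⊔ ℓ₁) where
        done : ∀ {σ} → ρ ⊢⟨for p ∈ [] , σ ⟩⇓[ 0 ] σ
        next : ∀ {i is σ σ′ σ″ τ τ′} →
               (i ∷ ρ) ⊢⟨ p , σ ⟩⇓[ τ ] σ′ → ρ ⊢⟨for p ∈ is , σ′ ⟩⇓[ τ′ ] σ″ →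
               ρ ⊢⟨for p ∈ i ∷ is , σ ⟩⇓[ 1 ℕ.+ (τ ℕ.+ τ′) ] σ″

infix 4 _∈O_

_∈O_ : (f g : ℕ → ℕ) → Set
f ∈O g = ∃₂ λ C N → ∀ n → N ℕ.≤ n → f n ℕ.≤ C ℕ.* g n

{-# OPTIONS --safe #-}

-- Let M = D − A.  A minimum principle for M on a strongly connected network
-- gives uniqueness for the Dirichlet problem with one boundary node.
--
-- The column f = F_{·mt} satisfies (I − P) f = eₘ − (πₘ/πₜ) eₜ with fₜ = 0, the
-- value at t being forced by π (I − P) = 0.  If B is L or Lᵖ and X is any matrix
-- with B X B = B, then f and X B f differ by a constant, which is the formula.
--
-- For the algorithm, column-reduce the pair X = I, Y = M, keeping Y = M X, with a
-- pivot at each node except the first, r; Dirichlet uniqueness makes the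
-- pivots nonzero.  In the end M Xₘ = eₘ − wₘ e_r with wₘ = δ_{rm} − Y_{rm} ≠ 0, so
--   F_{smt} = dₘ ((X_{sm} − X_{tm}) − (wₘ/wₜ) (X_{st} − X_{tt})),
-- and no degree is ever inverted (the degree of a single isolated node is 0).

module Submission where

open import Defs
open import Algebra.Bundles using (CommutativeRing; RawRing)
open import Data.Fin.Base as Fin using (Fin; zero; suc)
open import Data.Fin.Patterns using (0F; 1F; 2F)
open import Data.Fin.Properties as Fin using ()
open import Data.Fin.Subset using (Subset; _∉_; ⁅_⁆)
open import Data.Fin.Subset.Properties using (_∈?_; x∈⁅x⁆; x∈⁅y⁆⇒x≡y)
open import Data.List.Base as List using (List; []; _∷_; length; allFin)
open import Data.List.Membership.Propositional using () renaming (_∈_ to _∈ˡ_; _∉_ to _∉ˡ_)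
open import Data.List.Membership.Propositional.Properties using (∈-allFin)
open import Data.List.Properties using (≡-dec; length-tabulate)
open import Data.List.Relation.Unary.Any using (here; there)
open import Data.List.Relation.Unary.Unique.Propositional using (Unique; []; _∷_)
open import Data.List.Relation.Unary.Unique.Propositional.Properties using (allFin⁺)
open import Data.Maybe.Base using (Maybe; just; nothing)
open import Data.Nat.Base as ℕ using (ℕ; zero; suc)
open import Data.Product.Base using (_×_; Σ; ∃; ∃₂; _,_; proj₁; proj₂)
open import Data.Sum.Base using (_⊎_; inj₁; inj₂)
open import Data.Unit.Base using (⊤; tt)
open import Data.Vec.Base using (Vec; []; _∷_)
open import Function.Base using (_∘_; flip; _⟨_⟩_)
open import Level using (0ℓ; _⊔_; lift)
open import Relation.Binary.Bundles using (StrictTotalOrder)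
open import Relation.Binary.Construct.Closure.ReflexiveTransitive using (Star; ε; _◅_)
open import Relation.Binary.Definitions using (tri<; tri≈; tri>)
open import Relation.Binary.PropositionalEquality.Core as ≡ using (_≡_; _≢_)
open import Relation.Nullary using (¬_; Dec; yes; no; does; contradiction)
open import Relation.Nullary.Decidable using (dec-true; dec-false)
import Algebra.Properties.CommutativeSemigroup as CommutativeSemigroupProperties
import Algebra.Properties.Ring as RingProperties
import Algebra.Properties.Semiring.Mult as SemiringMult
import Algebra.Properties.Semiring.Sum as SemiringSum
import Algebra.Solver.Ring as RingSolver
import Algebra.Solver.Ring.AlmostCommutativeRing as ACR
import Data.Bool.Base as Bool
import Data.List.Membership.DecPropositional as DecMembership
import Data.List.Relation.Unary.All.Properties as All
import Data.Nat.Properties as ℕ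
import Data.Sum.Base as Sum
import Relation.Binary.Properties.StrictTotalOrder as StrictTotalOrderProperties
import Relation.Binary.Reasoning.Setoid as SetoidReasoning

-- An ordered field has no limits, so the fundamental matrix cannot be obtained as the sum of the
-- powers of the transient block of `P`. Comparing finitely many values at a minimum replaces that
-- argument.
--
-- A program cannot inspect field elements, so it can neither search for a pivot nor test one. The
-- pivot order is fixed in advance, and every pivot must be known to be nonzero for structural
-- reasons.
--
-- The program computes neither `π` nor a pseudo-inverse: the ratios of stationary probabilities
-- that the formulas need are read off from the row of the first node, which the reduction leaves
-- over. In the complexity claim the fundamental tensor is not given but constructed, as the output
-- of the program. The reduction directly yields a right inverse only; uniqueness for the Dirichlet
-- problem makes it two-sided.

-- The ring solver needs coefficients with computable equality: (a , b)
-- stands for the integer a − b.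
module IntegerCoefficients {c ℓ} (R : CommutativeRing c ℓ) where
  open CommutativeRing R
  open RingProperties ring
  open CommutativeSemigroupProperties +-commutativeSemigroup using (interchange)
  open SemiringMult semiring using (×-homo-+; ×1-homo-*) renaming (_×_ to _·_)
  open SetoidReasoning setoid

  value : ℕ × ℕ → Carrier
  value (a , b) = a · 1# - b · 1#

  private
    differences : RawRing 0ℓ 0ℓ
    differences = record
      { Carrier = ℕ × ℕ
      ; _≈_     = _≡_
      ; _+_     = λ (a , b) (d , e) → a ℕ.+ d , b ℕ.+ e
      ; _*_     = λ (a , b) (d , e) → a ℕ.* d ℕ.+ b ℕ.* e , a ℕ.* e ℕ.+ b ℕ.* d
      ; -_      = λ (a , b) → b , a
      ; 0#      = 0 , 0
      ; 1#      = 1 , 0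
      }

    +-difference : ∀ w x y z → (w + x) - (y + z) ≈ (w - y) + (x - z)
    +-difference w x y z =
      trans (+-congˡ (sym (-‿+-comm y z))) (interchange w x (- y) (- z))

    *-difference : ∀ w x y z →
      (w * y + x * z) - (w * z + x * y) ≈ (w - x) * (y - z)
    *-difference w x y z = begin
      (w * y + x * z) - (w * z + x * y)     ≈⟨ +-difference _ _ _ _ ⟩
      (w * y - w * z) + (x * z - x * y)     ≈⟨ +-congˡ (⁻¹-anti-homo‿- _ _) ⟨
      (w * y - w * z) - (x * y - x * z)     ≈⟨ +-cong (factor w) (-‿cong (factor x)) ⟩
      w * (y - z) - x * (y - z)             ≈⟨ +-congˡ (-‿distribˡ-* _ _) ⟩
      w * (y - z) + - x * (y - z)           ≈⟨ distribʳ _ _ _ ⟨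
      (w - x) * (y - z)                     ∎
      where
      factor : ∀ v → v * y - v * z ≈ v * (y - z)
      factor v = trans (+-congˡ (-‿distribʳ-* _ _)) (sym (distribˡ _ _ _))

    morphism : differences ACR.-Raw-AlmostCommutative⟶ ACR.fromCommutativeRing R
    morphism = record
      { ⟦_⟧    = value
      ; +-homo = λ (a , b) (d , e) → trans
          (+-cong (×-homo-+ 1# a d) (-‿cong (×-homo-+ 1# b e)))
          (+-difference _ _ _ _)
      ; *-homo = λ (a , b) (d , e) → trans
          (+-cong (homo a d b e) (-‿cong (homo a e b d)))
          (*-difference _ _ _ _)
      ; -‿homo = λ (a , b) → sym (⁻¹-anti-homo‿- _ _)
      ; 0-homo = -‿inverseʳ 0#
      ; 1-homo = trans (+-cong (+-identityʳ 1#) -0#≈0#) (+-identityʳ 1#)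
      }
      where
      homo : ∀ a d b e → (a ℕ.* d ℕ.+ b ℕ.* e) · 1# ≈
                         (a · 1#) * (d · 1#) + (b · 1#) * (e · 1#)
      homo a d b e = trans (×-homo-+ 1# (a ℕ.* d) (b ℕ.* e))
                           (+-cong (×1-homo-* a d) (×1-homo-* b e))

    _≟_ : ∀ p q → Maybe (value p ≈ value q)
    (a , b) ≟ (d , e) with a ℕ.+ e ℕ.≟ d ℕ.+ b
    ... | no  _         = nothing
    ... | yes a+e≡d+b = just (x∙y⁻¹≈ε⇒x≈y _ _ (begin
      value (a , b) - value (d , e)                      ≈⟨ +-congˡ (⁻¹-anti-homo‿- _ _) ⟩
      value (a , b) + (e · 1# - d · 1#)              ≈⟨ +-difference _ _ _ _ ⟨
      (a · 1# + e · 1#) - (b · 1# + d · 1#)      ≈⟨ +-congˡ (-‿cong (+-comm _ _)) ⟩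
      (a · 1# + e · 1#) - (d · 1# + b · 1#)
        ≈⟨ +-cong (×-homo-+ 1# a e) (-‿cong (×-homo-+ 1# d b)) ⟨
      (a ℕ.+ e) · 1# - (d ℕ.+ b) · 1#            ≡⟨ ≡.cong (λ k → k · 1# - (d ℕ.+ b) · 1#) a+e≡d+b ⟩
      (d ℕ.+ b) · 1# - (d ℕ.+ b) · 1#            ≈⟨ -‿inverseʳ _ ⟩
      0#                                         ∎))

  open RingSolver differences (ACR.fromCommutativeRing R) morphism _≟_ public

-- Ordered fields: inequalities, inverses and finite sums.

module OrderedFieldProperties {c ℓ₁ ℓ₂} (K : OrderedField c ℓ₁ ℓ₂) where
  open OrderedField K hiding (zero)
  open RingProperties ring using (-0#≈0#; -‿distribʳ-*; x∙y⁻¹≈ε⇒x≈y)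
  open IntegerCoefficients commutativeRing using (solve; _:=_; _:+_; _:-_; _:*_; :-_)

  strictTotalOrder : StrictTotalOrder c ℓ₁ ℓ₂
  strictTotalOrder = record { isStrictTotalOrder = isStrictTotalOrder }

  open StrictTotalOrder strictTotalOrder public
    using (compare; <-respˡ-≈; <-respʳ-≈; irrefl) renaming (trans to <-trans)
  open StrictTotalOrderProperties strictTotalOrder public
    using () renaming (trans to ≤-trans; antisym to ≤-antisym; reflexive to ≤-reflexive; total to ≤-total)

  <-≤-trans : ∀ {x y z} → x < y → y ≤ z → x < z
  <-≤-trans x<y (inj₁ y<z) = <-trans x<y y<z
  <-≤-trans x<y (inj₂ y≈z) = <-respʳ-≈ y≈z x<y

  pos⇒≉0 : ∀ {x} → 0# < x → ¬ x ≈ 0#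
  pos⇒≉0 0<x x≈0 = irrefl (sym x≈0) 0<x

  neg⇒-pos : ∀ {x} → x < 0# → 0# < - x
  neg⇒-pos {x} x<0 = <-respˡ-≈ (-‿inverseʳ x) (<-respʳ-≈ (+-identityˡ (- x)) (+-monoˡ-< (- x) x<0))

  0<1 : 0# < 1#
  0<1 with compare 0# 1#
  ... | tri< 0<1 _ _ = 0<1
  ... | tri≈ _ 0≈1 _ = contradiction 0≈1 0≉1
  ... | tri> _ _ 1<0 = <-respʳ-≈ (solve 1 (λ x → :- x :* :- x := x :* x) refl 1# ⟨ trans ⟩ *-identityʳ 1#)
                                 (*-pos (neg⇒-pos 1<0) (neg⇒-pos 1<0))

  +-monoˡ-≤ : ∀ {x y} z → x ≤ y → x + z ≤ y + z
  +-monoˡ-≤ z (inj₁ x<y) = inj₁ (+-monoˡ-< z x<y)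
  +-monoˡ-≤ z (inj₂ x≈y) = inj₂ (+-congʳ x≈y)

  +-monoʳ-≤ : ∀ {x y} z → x ≤ y → z + x ≤ z + y
  +-monoʳ-≤ z x≤y = ≤-trans (≤-reflexive (+-comm z _)) (≤-trans (+-monoˡ-≤ z x≤y) (≤-reflexive (+-comm _ z)))

  ≤⇒0≤- : ∀ {x y} → x ≤ y → 0# ≤ y - x
  ≤⇒0≤- {x} x≤y = ≤-trans (≤-reflexive (sym (-‿inverseʳ x))) (+-monoˡ-≤ (- x) x≤y)

  0≤-⇒≤ : ∀ {x y} → 0# ≤ y - x → x ≤ y
  0≤-⇒≤ {x} {y} 0≤y-x = ≤-trans (≤-reflexive (sym (+-identityˡ x)))
    (≤-trans (+-monoˡ-≤ x 0≤y-x) (≤-reflexive (solve 2 (λ x y → y :- x :+ x := y) refl x y)))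

  +-nonneg : ∀ {x y} → 0# ≤ x → 0# ≤ y → 0# ≤ x + y
  +-nonneg {x} 0≤x 0≤y = ≤-trans 0≤x (≤-trans (≤-reflexive (sym (+-identityʳ x))) (+-monoʳ-≤ x 0≤y))

  *-nonneg : ∀ {x y} → 0# ≤ x → 0# ≤ y → 0# ≤ x * y
  *-nonneg (inj₁ 0<x) (inj₁ 0<y) = inj₁ (*-pos 0<x 0<y)
  *-nonneg (inj₂ 0≈x) _          = inj₂ (sym (trans (*-congʳ (sym 0≈x)) (zeroˡ _)))
  *-nonneg (inj₁ _)   (inj₂ 0≈y) = inj₂ (sym (trans (*-congˡ (sym 0≈y)) (zeroʳ _)))

  ⁻¹-pos : ∀ {x} → 0# < x → 0# < x ⁻¹
  ⁻¹-pos {x} 0<x with compare 0# (x ⁻¹)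
  ... | tri< 0<x⁻¹ _ _ = 0<x⁻¹
  ... | tri≈ _ 0≈x⁻¹ _ = contradiction
    (trans (sym (zeroʳ x)) (trans (*-congˡ 0≈x⁻¹) (⁻¹-inverseʳ (pos⇒≉0 0<x)))) 0≉1
  ... | tri> _ _ x⁻¹<0 = contradiction (<-trans 0<1 1<0) (irrefl refl)
    where
    0<-1 : 0# < - 1#
    0<-1 = <-respʳ-≈ (trans (sym (-‿distribʳ-* _ _)) (-‿cong (⁻¹-inverseʳ (pos⇒≉0 0<x))))
                     (*-pos 0<x (neg⇒-pos x⁻¹<0))
    1<0 : 1# < 0#
    1<0 = <-respˡ-≈ (+-identityˡ 1#) (<-respʳ-≈ (-‿inverseˡ 1#) (+-monoˡ-< 1# 0<-1))

  ⁻¹-inverseˡ : ∀ {x} → ¬ x ≈ 0# → x ⁻¹ * x ≈ 1#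
  ⁻¹-inverseˡ x≉0 = trans (*-comm _ _) (⁻¹-inverseʳ x≉0)

  *-cancelˡ : ∀ {x y z} → ¬ x ≈ 0# → x * y ≈ x * z → y ≈ z
  *-cancelˡ {x} {y} {z} x≉0 xy≈xz = trans (sym (collapse y)) (trans (*-congˡ xy≈xz) (collapse z))
    where
    collapse : ∀ v → x ⁻¹ * (x * v) ≈ v
    collapse v = trans (sym (*-assoc _ _ _)) (trans (*-congʳ (⁻¹-inverseˡ x≉0)) (*-identityˡ v))

  -≈0⇒≈ : ∀ {x y} → x - y ≈ 0# → x ≈ y
  -≈0⇒≈ = x∙y⁻¹≈ε⇒x≈y _ _

  argmin : ∀ {n} (x : Fin (suc n) → Carrier) → ∃ λ i → ∀ j → x i ≤ x j
  argmin {zero}  x = zero , λ { zero → ≤-reflexive refl }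
  argmin {suc n} x with argmin (x ∘ suc)
  ... | i , min with ≤-total (x zero) (x (suc i))
  ...   | inj₁ x₀≤ = zero  , λ { zero → ≤-reflexive refl ; (suc j) → ≤-trans x₀≤ (min j) }
  ...   | inj₂ ≤x₀ = suc i , λ { zero → ≤x₀ ; (suc j) → min j }

  open SemiringSum semiring public
    using (sum-cong-≋; ∑-distrib-+; ∑-comm; *-distribˡ-sum; *-distribʳ-sum; sum-replicate-zero)

  sum-zero : ∀ {n} {x : Fin n → Carrier} → (∀ i → x i ≈ 0#) → sum x ≈ 0#
  sum-zero {n} x≈0 = trans (sum-cong-≋ x≈0) (sum-replicate-zero n)

  sum-neg : ∀ {n} (x : Fin n → Carrier) → sum (λ i → - x i) ≈ - sum x
  sum-neg {zero}  x = sym -0#≈0#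
  sum-neg {suc n} x = trans (+-congˡ (sum-neg (x ∘ suc))) (solve 2 (λ a b → :- a :+ :- b := :- (a :+ b)) refl _ _)

  sum-sub : ∀ {n} (x y : Fin n → Carrier) → sum (λ i → x i - y i) ≈ sum x - sum y
  sum-sub x y = trans (∑-distrib-+ x (λ i → - y i)) (+-congˡ (sum-neg y))

  sum-nonneg : ∀ {n} {x : Fin n → Carrier} → (∀ i → 0# ≤ x i) → 0# ≤ sum x
  sum-nonneg {zero}  0≤x = ≤-reflexive refl
  sum-nonneg {suc n} 0≤x = +-nonneg (0≤x zero) (sum-nonneg (0≤x ∘ suc))

  term≤sum : ∀ {n} {x : Fin n → Carrier} → (∀ i → 0# ≤ x i) → ∀ i → x i ≤ sum x
  term≤sum {suc n} {x} 0≤x zero =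
    ≤-trans (≤-reflexive (sym (+-identityʳ _))) (+-monoʳ-≤ _ (sum-nonneg {x = x ∘ suc} (0≤x ∘ suc)))
  term≤sum {suc n} {x} 0≤x (suc i) =
    ≤-trans (term≤sum {x = x ∘ suc} (0≤x ∘ suc) i)
            (≤-trans (≤-reflexive (sym (+-identityˡ _))) (+-monoˡ-≤ _ (0≤x zero)))

  sum-pos : ∀ {n} {x : Fin n → Carrier} → (∀ i → 0# ≤ x i) → 0# < sum x → ∃ λ i → 0# < x i
  sum-pos {zero}      0≤x 0<sum = contradiction 0<sum (irrefl refl)
  sum-pos {suc n} {x} 0≤x 0<sum with 0≤x zero
  ... | inj₁ 0<x₀ = zero , 0<x₀
  ... | inj₂ 0≈x₀ with sum-pos {x = x ∘ suc} (0≤x ∘ suc)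
                         (<-respʳ-≈ (trans (+-congʳ (sym 0≈x₀)) (+-identityˡ _)) 0<sum)
  ...   | i , 0<xᵢ = suc i , 0<xᵢ

-- Matrices acting on vectors.

module LinearAlgebra {c ℓ₁ ℓ₂} (K : OrderedField c ℓ₁ ℓ₂) where
  open OrderedField K hiding (zero)
  open OrderedFieldProperties K
  open RandomWalks K
  open IntegerCoefficients commutativeRing using (solve; _:=_; _:+_; _:-_; _:*_; :-_)
  open SetoidReasoning setoid

  infixr 7 _·_

  Vector : ℕ → Set c
  Vector n = Fin n → Carrier

  _·_ : ∀ {n} → Matrix {n} → Vector n → Vector n
  (M · x) i = sum (λ j → M i j * x j)

  diag-refl : ∀ {n} (d : Vector n) i → diag d i i ≈ d i
  diag-refl d i with i Fin.≟ i
  ... | yes _  = refl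
  ... | no i≢i = contradiction ≡.refl i≢i

  diag-off : ∀ {n} (d : Vector n) {i j} → i ≢ j → diag d i j ≈ 0#
  diag-off d {i} {j} i≢j with i Fin.≟ j
  ... | yes i≡j = contradiction i≡j i≢j
  ... | no  _   = refl

  diag≈*δ : ∀ {n} (d : Vector n) i j → diag d i j ≈ d i * 1ᴹ i j
  diag≈*δ d i j with does (i Fin.≟ j)
  ... | Bool.true  = sym (*-identityʳ _)
  ... | Bool.false = sym (zeroʳ _)

  -- Off the diagonal both sides vanish. This trades a factor that depends on the row, such as `π s`
  -- or `degree s`, for one that is constant along the column.
  weight-basis : ∀ {n} (d : Vector n) i j → d i * 1ᴹ i j ≈ d j * 1ᴹ i j
  weight-basis d i j with i Fin.≟ j
  ... | yes ≡.refl = refl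
  ... | no  _      = trans (zeroʳ _) (sym (zeroʳ _))

  sum-single : ∀ {n} {x : Vector n} i → (∀ j → j ≢ i → x j ≈ 0#) → sum x ≈ x i
  sum-single zero    x≈0 = trans (+-congˡ (sum-zero (λ j → x≈0 (suc j) λ ()))) (+-identityʳ _)
  sum-single (suc i) x≈0 = trans
    (+-cong (x≈0 zero λ ()) (sum-single i (λ j j≢i → x≈0 (suc j) (j≢i ∘ Fin.suc-injective))))
    (+-identityˡ _)

  diag-· : ∀ {n} (d x : Vector n) i → (diag d · x) i ≈ d i * x i
  diag-· d x i = trans
    (sum-single i (λ j j≢i → trans (*-congʳ (diag-off d (j≢i ∘ ≡.sym))) (zeroˡ _)))
    (*-congʳ (diag-refl d i))

  ·-basis : ∀ {n} (M : Matrix {n}) i j → (M · flip 1ᴹ j) i ≈ M i j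
  ·-basis M i j = trans
    (sum-single j (λ k k≢j → trans (*-congˡ (diag-off _ k≢j)) (zeroʳ _)))
    (trans (*-congˡ (diag-refl _ j)) (*-identityʳ _))

  ·-cong : ∀ {n} (M : Matrix {n}) {x y} → (∀ j → x j ≈ y j) → ∀ i → (M · x) i ≈ (M · y) i
  ·-cong M x≈y i = sum-cong-≋ (λ j → *-congˡ (x≈y j))

  ·-sub : ∀ {n} (M : Matrix {n}) x y i → (M · (λ j → x j - y j)) i ≈ (M · x) i - (M · y) i
  ·-sub {n} M x y i = begin
    sum (λ j → M i j * (x j - y j))
      ≈⟨ sum-cong-≋ {n} (λ j → solve 3 (λ m x y → m :* (x :- y) := m :* x :- m :* y) refl
           (M i j) (x j) (y j)) ⟩
    sum (λ j → M i j * x j - M i j * y j)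
      ≈⟨ sum-sub {n} _ _ ⟩
    (M · x) i - (M · y) i ∎

  ·-scale : ∀ {n} (M : Matrix {n}) a x i → (M · (λ j → a * x j)) i ≈ a * (M · x) i
  ·-scale {n} M a x i = begin
    sum (λ j → M i j * (a * x j))
      ≈⟨ sum-cong-≋ {n} (λ j → solve 3 (λ m a x → m :* (a :* x) := a :* (m :* x)) refl
           (M i j) a (x j)) ⟩
    sum (λ j → a * (M i j * x j))
      ≈⟨ *-distribˡ-sum {n} a _ ⟨
    a * (M · x) i ∎

  *ᴹ-· : ∀ {n} (M N : Matrix {n}) x i → ((M *ᴹ N) · x) i ≈ (M · (N · x)) i
  *ᴹ-· {n} M N x i = begin
    sum (λ j → sum (λ k → M i k * N k j) * x j)
      ≈⟨ sum-cong-≋ {n} (λ j → *-distribʳ-sum {n} (x j) _) ⟩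
    sum (λ j → sum (λ k → M i k * N k j * x j))    ≈⟨ ∑-comm {n} {n} _ ⟩
    sum (λ k → sum (λ j → M i k * N k j * x j))
      ≈⟨ sum-cong-≋ {n} (λ k → sum-cong-≋ {n} (λ j → *-assoc _ _ _)) ⟩
    sum (λ k → sum (λ j → M i k * (N k j * x j)))
      ≈⟨ sum-cong-≋ {n} (λ k → *-distribˡ-sum {n} (M i k) _) ⟨
    sum (λ k → M i k * sum (λ j → N k j * x j))    ∎

-- Graph Laplacian, minimum principle and Dirichlet uniqueness.

module NetworkProperties {c ℓ₁ ℓ₂} (K : OrderedField c ℓ₁ ℓ₂) where
  open OrderedField K hiding (zero)
  open OrderedFieldProperties K
  open RandomWalks K
  open LinearAlgebra K
  open RingProperties ring using (-0#≈0#)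
  open IntegerCoefficients commutativeRing using (solve; _:=_; _:+_; _:-_; _:*_; :-_)
  open SetoidReasoning setoid

  graphLaplacian : ∀ {n} → Network n → Matrix {n}
  graphLaplacian G = diag (Network.degree G) -ᴹ Network.affinity G

  module _ {n} (G : Network n) where
    open Network G

    private
      M = graphLaplacian G

    -- The row sums of the Laplacian vanish, so only differences of values enter. In this form the
    -- sign of each term at a minimum is visible.
    graphLaplacian-· : ∀ x i → (M · x) i ≈ sum (λ j → affinity i j * (x i - x j))
    graphLaplacian-· x i = begin
      sum (λ j → (diag degree i j - affinity i j) * x j)
        ≈⟨ sum-cong-≋ {n} (λ j → solve 3 (λ d a x → (d :- a) :* x := d :* x :- a :* x) refl
             (diag degree i j) (affinity i j) (x j)) ⟩
      sum (λ j → diag degree i j * x j - affinity i j * x j)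
        ≈⟨ sum-sub {n} _ _ ⟩
      (diag degree · x) i - (affinity · x) i
        ≈⟨ +-congʳ (trans (diag-· degree x i) (*-distribʳ-sum {n} (x i) _)) ⟩
      sum (λ j → affinity i j * x i) - (affinity · x) i
        ≈⟨ sum-sub {n} _ _ ⟨
      sum (λ j → affinity i j * x i - affinity i j * x j)
        ≈⟨ sum-cong-≋ {n} (λ j → solve 3 (λ a x y → a :* x :- a :* y := a :* (x :- y)) refl
             (affinity i j) (x i) (x j)) ⟩
      sum (λ j → affinity i j * (x i - x j)) ∎

    graphLaplacian-const : ∀ {x} → (∀ i j → x i ≈ x j) → ∀ i → (M · x) i ≈ 0#
    graphLaplacian-const {x} const i = trans (graphLaplacian-· x i)
      (sum-zero (λ j → trans (*-congˡ (trans (+-congʳ (const i j)) (-‿inverseʳ _))) (zeroʳ _)))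

    Edge⇒degree-pos : ∀ {i j} → Edge i j → 0# < degree i
    Edge⇒degree-pos {i} {j} 0<aᵢⱼ = <-≤-trans 0<aᵢⱼ (term≤sum {x = affinity i} (nonneg i) j)

    P-entry : ∀ i j → P i j ≈ degree i ⁻¹ * affinity i j
    P-entry i j = diag-· (λ i → degree i ⁻¹) (λ k → affinity k j) i

    -- Positivity is what makes `degree i * degree i ⁻¹` cancel, since the inverse of zero is
    -- unspecified. Results about `M` reach `I − P` through this row scaling.
    degree*randomWalkLaplacian : ∀ {i} → 0# < degree i → ∀ x →
      degree i * (randomWalkLaplacian G · x) i ≈ (M · x) i
    degree*randomWalkLaplacian {i} 0<d x = trans (*-distribˡ-sum {n} _ _) (sum-cong-≋ {n} (λ j → begin
      degree i * ((1ᴹ i j - P i j) * x j)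
        ≈⟨ *-congˡ (*-congʳ (+-congˡ (-‿cong (P-entry i j)))) ⟩
      degree i * ((1ᴹ i j - degree i ⁻¹ * affinity i j) * x j)
        ≈⟨ solve 5 (λ d e w a x → d :* ((w :- e :* a) :* x) := (d :* w :- (d :* e) :* a) :* x) refl
             (degree i) (degree i ⁻¹) (1ᴹ i j) (affinity i j) (x j) ⟩
      (degree i * 1ᴹ i j - degree i * degree i ⁻¹ * affinity i j) * x j
        ≈⟨ *-congʳ (+-cong (sym (diag≈*δ degree i j))
             (-‿cong (trans (*-congʳ (⁻¹-inverseʳ (pos⇒≉0 0<d))) (*-identityˡ _)))) ⟩
      M i j * x j ∎))

  module _ {n} (G : Network n) (connected : StronglyConnected G) where
    open Network G

    private
      M = graphLaplacian G
      Q = randomWalkLaplacian G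

    -- A path to a different node starts with an edge. The second node matters: a lone node may have
    -- degree zero.
    degree-pos : ∀ {i j} → i ≢ j → 0# < degree i
    degree-pos {i} {j} i≢j with connected i j
    ... | ε        = contradiction ≡.refl i≢j
    ... | edge ◅ _ = Edge⇒degree-pos G edge

    private
      -- At a minimum of x every term of the sum (M x)ᵢ = ∑ aᵢⱼ (xᵢ − xⱼ) is ≤ 0.
      neighbour-of-min : ∀ {x i j} → (∀ k → x i ≤ x k) → 0# ≤ (M · x) i → Edge i j → x j ≈ x i
      neighbour-of-min {x} {i} {j} min 0≤Mx edge = -≈0⇒≈ (*-cancelˡ (pos⇒≉0 edge)
        (trans (≤-antisym (≤-trans (term≤sum 0≤terms j) sum≤0) (0≤terms j)) (sym (zeroʳ _))))
        where
        0≤terms : ∀ k → 0# ≤ affinity i k * (x k - x i)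
        0≤terms k = *-nonneg (nonneg i k) (≤⇒0≤- (min k))
        sum≤0 : sum (λ k → affinity i k * (x k - x i)) ≤ 0#
        sum≤0 = 0≤-⇒≤ (≤-trans 0≤Mx (≤-reflexive (begin
          (M · x) i                                    ≈⟨ graphLaplacian-· G x i ⟩
          sum (λ k → affinity i k * (x i - x k))
            ≈⟨ sum-cong-≋ {n} (λ k → solve 3 (λ a u v → a :* (u :- v) := :- (a :* (v :- u))) refl
                 (affinity i k) (x i) (x k)) ⟩
          sum (λ k → - (affinity i k * (x k - x i)))   ≈⟨ sum-neg {n} _ ⟩
          - sum (λ k → affinity i k * (x k - x i))     ≈⟨ +-identityˡ _ ⟨
          0# - sum (λ k → affinity i k * (x k - x i))  ∎)))

      -- The minimal value is handed from node to node along the path, until `r` is reached or a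
      -- node known to share the value of `r`.
      min-along-path : ∀ {x i r} → (∀ k → x i ≤ x k) → (∀ j → x j ≈ x r ⊎ 0# ≤ (M · x) j) →
        Star Edge i r → x r ≈ x i
      min-along-path min super ε = refl
      min-along-path {i = i} min super (edge ◅ path) with super i
      ... | inj₁ xᵢ≈xᵣ = sym xᵢ≈xᵣ
      ... | inj₂ 0≤Mx = trans (min-along-path (λ k → ≤-trans (≤-reflexive xⱼ≈xᵢ) (min k)) super path) xⱼ≈xᵢ
        where xⱼ≈xᵢ = neighbour-of-min min 0≤Mx edge

    -- The boundary is described by the value `x r` and not by the node `r`, so any node with that
    -- value counts as boundary. `pivot≉0` relies on this for the nodes whose pivots are still
    -- pending.
    minimum-principle : ∀ {x} r → (∀ i → x i ≈ x r ⊎ 0# ≤ (M · x) i) → ∀ i → x r ≤ x i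
    minimum-principle {x} r super i = ≤-trans (≤-reflexive (min-along-path min super (connected k r))) (min i)
      where
      attained : ∃ λ k → ∀ j → x k ≤ x j
      -- The node `r` witnesses that the network is nonempty, as `argmin` requires.
      attained = attainedAt x {r}
        where
        attainedAt : ∀ {n} (x : Fin n → Carrier) {_ : Fin n} → ∃ λ k → ∀ j → x k ≤ x j
        attainedAt {suc _} x = argmin x
      k   = proj₁ attained
      min = proj₂ attained

    -- The minimum principle is applied to `x` and to its negative.
    dirichlet-uniqueness : ∀ {x} r → (∀ i → x i ≈ x r ⊎ (M · x) i ≈ 0#) → ∀ i → x i ≈ x r
    dirichlet-uniqueness {x} r harmonic i = ≤-antisym
      (0≤-⇒≤ (≤-trans (≤⇒0≤- (minimum-principle {λ j → - x j} r super⁻ i))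
        (≤-reflexive (solve 2 (λ a b → :- a :- :- b := b :- a) refl (x i) (x r)))))
      (minimum-principle r super⁺ i)
      where
      super⁺ : ∀ i → x i ≈ x r ⊎ 0# ≤ (M · x) i
      super⁺ i = Sum.map₂ (≤-reflexive ∘ sym) (harmonic i)
      super⁻ : ∀ i → - x i ≈ - x r ⊎ 0# ≤ (M · (λ j → - x j)) i
      super⁻ i = Sum.map -‿cong
        (λ Mx≈0 → ≤-reflexive (sym (begin
          (M · (λ j → - x j)) i
            ≈⟨ sum-cong-≋ {n} (λ j → solve 2 (λ m x → m :* :- x := :- (m :* x)) refl
                 (M i j) (x j)) ⟩
          sum (λ j → - (M i j * x j))   ≈⟨ sum-neg {n} _ ⟩
          - (M · x) i                   ≈⟨ -‿cong Mx≈0 ⟩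
          - 0#                          ≈⟨ -0#≈0# ⟩
          0#                            ∎)))
        (harmonic i)

    -- For each `j`, such a vector solves the Dirichlet problem with `j` as the boundary node.
    randomWalkLaplacian-kernel : ∀ {x} → (∀ i → (Q · x) i ≈ 0#) → ∀ i j → x i ≈ x j
    randomWalkLaplacian-kernel {x} Qx≈0 i j with i Fin.≟ j
    ... | yes ≡.refl = refl
    ... | no i≢j = dirichlet-uniqueness j harmonic i
      where
      harmonic : ∀ k → x k ≈ x j ⊎ (M · x) k ≈ 0#
      harmonic k with k Fin.≟ j
      ... | yes ≡.refl = inj₁ refl
      ... | no k≢j = inj₂ (trans (sym (degree*randomWalkLaplacian G (degree-pos k≢j) x))
                                 (trans (*-congˡ (Qx≈0 k)) (zeroʳ _)))

-- Fundamental tensors as Green functions of the Dirichlet problem.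

module FundamentalTensors {c ℓ₁ ℓ₂} (K : OrderedField c ℓ₁ ℓ₂) where
  open OrderedField K hiding (zero)
  open OrderedFieldProperties K
  open RandomWalks K
  open LinearAlgebra K
  open NetworkProperties K
  open SetoidReasoning setoid

  ∉⁅⁆⇒≢ : ∀ {n} {i t : Fin n} → i ∉ ⁅ t ⁆ → i ≢ t
  ∉⁅⁆⇒≢ i∉ ≡.refl = i∉ (x∈⁅x⁆ _)

  ≢⇒∉⁅⁆ : ∀ {n} {i t : Fin n} → i ≢ t → i ∉ ⁅ t ⁆
  ≢⇒∉⁅⁆ i≢t i∈ = i≢t (x∈⁅y⁆⇒x≡y _ i∈)

  -- The full sum has one extra term, at `t`, and it is zero. Matrix products over the transient
  -- nodes thereby become products over all nodes.
  sumᵀ-extend : ∀ {n} t {f : 𝒯 ⁅ t ⁆ → Carrier} {g : Vector n} →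
    (∀ k p → f (k , p) ≈ g k) → g t ≈ 0# → sumᵀ ⁅ t ⁆ f ≈ sum g
  sumᵀ-extend {n} t {f} {g} f≈g gₜ≈0 = sum-cong-≋ {n} pointwise
    where
    pointwise : ∀ k → extend ⁅ t ⁆ f k ≈ g k
    pointwise k with k ∈? ⁅ t ⁆
    ... | yes k∈ = trans (sym gₜ≈0) (reflexive (≡.cong g (≡.sym (x∈⁅y⁆⇒x≡y t k∈))))
    ... | no  k∉ = f≈g k k∉

  1ᵀ≈1ᴹ : ∀ {n} (𝒜 : Subset n) i j {p q} → Transient.1ᴹ 𝒜 (i , p) (j , q) ≈ 1ᴹ i j
  1ᵀ≈1ᴹ 𝒜 i j with i Fin.≟ j
  ... | yes ≡.refl = refl
  ... | no  _      = refl

  module _ {n} (F : ∀ t → Transient.Matrix {n} ⁅ t ⁆) where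

    tensor-inside : ∀ s m t {p q} → tensor F s m t ≈ F t (s , p) (m , q)
    tensor-inside s m t {p} {q} with s ∈? ⁅ t ⁆ | m ∈? ⁅ t ⁆
    ... | no  _  | no  _  = refl
    ... | yes s∈ | _      = contradiction s∈ p
    ... | no  _  | yes m∈ = contradiction m∈ q

    tensor-start : ∀ m t → tensor F t m t ≈ 0#
    tensor-start m t with t ∈? ⁅ t ⁆ | m ∈? ⁅ t ⁆
    ... | no t∉ | _ = contradiction (x∈⁅x⁆ t) t∉
    ... | yes _ | _ = refl

    tensor-visit : ∀ s t → tensor F s t t ≈ 0#
    tensor-visit s t with s ∈? ⁅ t ⁆ | t ∈? ⁅ t ⁆
    ... | _     | no t∉ = contradiction (x∈⁅x⁆ t) t∉
    ... | yes _ | yes _ = refl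
    ... | no  _ | yes _ = refl

  -- The fundamental matrices extended by zero, so that all equations live on the full node set.
  -- Only the right-inverse half is recorded; `green-leftInverse` recovers the other.
  record IsGreenTensor {n} (G : Network n) (𝐅 : Tensor n) : Set ℓ₁ where
    field
      from-target : ∀ m t → 𝐅 t m t ≈ 0#
      at-target   : ∀ s t → 𝐅 s t t ≈ 0#
      inverse     : ∀ {s m t} → s ≢ t → m ≢ t →
                    (randomWalkLaplacian G · (λ k → 𝐅 k m t)) s ≈ 1ᴹ s m

  module _ {n} (G : Network n) (F : ∀ t → Transient.Matrix {n} ⁅ t ⁆) (𝐅 : Tensor n)
           (𝐅≈F : ∀ s m t → 𝐅 s m t ≈ tensor F s m t) where
    open Network G

    private
      Q = randomWalkLaplacian G

      module 𝓣 t = Transient {n} ⁅ t ⁆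

      Qᵀ : ∀ t → 𝓣.Matrix t
      Qᵀ t = 𝓣._-ᴹ_ t (𝓣.1ᴹ t) (principalSubmatrix ⁅ t ⁆ P)

      Qᵀ-entry : ∀ t i j {p q} → Qᵀ t (i , p) (j , q) ≈ Q i j
      Qᵀ-entry t i j = +-congʳ (1ᵀ≈1ᴹ ⁅ t ⁆ i j)

      F-entry : ∀ s m t {p q} → F t (s , p) (m , q) ≈ 𝐅 s m t
      F-entry s m t = sym (trans (𝐅≈F s m t) (tensor-inside F s m t))

    Q*F-entry : ∀ s m t {p q} →
      𝓣._*ᴹ_ t (Qᵀ t) (F t) (s , p) (m , q) ≈ (Q · (λ k → 𝐅 k m t)) s
    Q*F-entry s m t = sumᵀ-extend t
      (λ k _ → *-cong (Qᵀ-entry t s k) (F-entry k m t))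
      (trans (*-congˡ (trans (𝐅≈F t m t) (tensor-start F m t))) (zeroʳ _))

    F*Q-entry : ∀ s m t {p q} →
      𝓣._*ᴹ_ t (F t) (Qᵀ t) (s , p) (m , q) ≈ sum (λ k → 𝐅 s k t * Q k m)
    F*Q-entry s m t = sumᵀ-extend t
      (λ k _ → *-cong (F-entry s k t) (Qᵀ-entry t k m))
      (trans (*-congʳ (trans (𝐅≈F s t t) (tensor-visit F s t))) (zeroˡ _))

  fundamental⇒green : ∀ {n} (G : Network n) {𝐅} → IsFundamentalTensor G 𝐅 → IsGreenTensor G 𝐅
  fundamental⇒green G {𝐅} (F , isFundamental , 𝐅≈F) = record
    { from-target = λ m t → trans (𝐅≈F t m t) (tensor-start F m t)
    ; at-target   = λ s t → trans (𝐅≈F s t t) (tensor-visit F s t)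
    ; inverse     = λ {s} {m} {t} s≢t m≢t → trans
        (sym (Q*F-entry G F 𝐅 𝐅≈F s m t {≢⇒∉⁅⁆ s≢t} {≢⇒∉⁅⁆ m≢t}))
        (trans (proj₁ (isFundamental t) _ _) (1ᵀ≈1ᴹ ⁅ t ⁆ s m))
    }

  -- F (Q eₘ) and eₘ both solve the Dirichlet problem Q x = Q eₘ off t with
  -- xₜ = 0, so the right inverse F is also a left inverse.
  green-leftInverse : ∀ {n} (G : Network n) → StronglyConnected G → ∀ {𝐅} → IsGreenTensor G 𝐅 →
    ∀ {s m t} → s ≢ t → m ≢ t → sum (λ k → 𝐅 s k t * randomWalkLaplacian G k m) ≈ 1ᴹ s m
  green-leftInverse {n} G connected {𝐅} green {s} {m} {t} s≢t m≢t = -≈0⇒≈ (begin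
    (𝐅ₜ · q) s - 1ᴹ s m
      ≈⟨ dirichlet-uniqueness G connected {λ k → (𝐅ₜ · q) k - 1ᴹ k m} t harmonic s ⟩
    (𝐅ₜ · q) t - 1ᴹ t m
      ≈⟨ +-cong (sum-zero {n} (λ k → trans (*-congʳ (from-target k t)) (zeroˡ _)))
                (-‿cong (diag-off _ (m≢t ∘ ≡.sym))) ⟩
    0# - 0#
      ≈⟨ -‿inverseʳ 0# ⟩
    0# ∎)
    where
    open IsGreenTensor green
    Q  = randomWalkLaplacian G
    𝐅ₜ : Matrix
    𝐅ₜ i j = 𝐅 i j t
    q : Vector n
    q k = Q k m
    QF≈1 : ∀ {i} → i ≢ t → ∀ k → (Q *ᴹ 𝐅ₜ) i k ≈ 1ᴹ i k
    QF≈1 {i} i≢t k with k Fin.≟ t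
    ... | no  k≢t    = inverse i≢t k≢t
    ... | yes ≡.refl = trans (sum-zero {n} (λ l → trans (*-congˡ (at-target l k)) (zeroʳ _)))
                             (sym (diag-off _ i≢t))
    vanishes : ∀ {i} → i ≢ t → (Q · (λ k → (𝐅ₜ · q) k - 1ᴹ k m)) i ≈ 0#
    vanishes {i} i≢t = begin
      (Q · (λ k → (𝐅ₜ · q) k - 1ᴹ k m)) i   ≈⟨ ·-sub Q (𝐅ₜ · q) (flip 1ᴹ m) i ⟩
      (Q · (𝐅ₜ · q)) i - (Q · flip 1ᴹ m) i
        ≈⟨ +-cong (sym (*ᴹ-· Q 𝐅ₜ q i)) (-‿cong (·-basis Q i m)) ⟩
      ((Q *ᴹ 𝐅ₜ) · q) i - q i
        ≈⟨ +-congʳ (sum-cong-≋ {n} (λ k → *-congʳ (QF≈1 i≢t k))) ⟩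
      (1ᴹ · q) i - q i                      ≈⟨ +-congʳ (trans (diag-· _ q i) (*-identityˡ _)) ⟩
      q i - q i                             ≈⟨ -‿inverseʳ _ ⟩
      0#                                    ∎
    harmonic : ∀ i → (𝐅ₜ · q) i - 1ᴹ i m ≈ (𝐅ₜ · q) t - 1ᴹ t m ⊎
                     (graphLaplacian G · (λ k → (𝐅ₜ · q) k - 1ᴹ k m)) i ≈ 0#
    harmonic i with i Fin.≟ t
    ... | yes ≡.refl = inj₁ refl
    ... | no  i≢t    = inj₂ (trans
      (sym (degree*randomWalkLaplacian G (degree-pos G connected i≢t) (λ k → (𝐅ₜ · q) k - 1ᴹ k m)))
      (trans (*-congˡ (vanishes i≢t)) (zeroʳ _)))

  green⇒fundamental : ∀ {n} (G : Network n) → StronglyConnected G → ∀ {𝐅} →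
    IsGreenTensor G 𝐅 → IsFundamentalTensor G 𝐅
  green⇒fundamental {n} G connected {𝐅} green = F , isFundamental , 𝐅≈F
    where
    open IsGreenTensor green
    F : ∀ t → Transient.Matrix {n} ⁅ t ⁆
    F t (s , _) (m , _) = 𝐅 s m t
    𝐅≈F : ∀ s m t → 𝐅 s m t ≈ tensor F s m t
    𝐅≈F s m t with s ∈? ⁅ t ⁆ | m ∈? ⁅ t ⁆
    ... | no  _  | no  _  = refl
    ... | yes s∈ | _      with ≡.refl ← x∈⁅y⁆⇒x≡y t s∈ = from-target m t
    ... | no  _  | yes m∈ with ≡.refl ← x∈⁅y⁆⇒x≡y t m∈ = at-target s t
    isFundamental : ∀ t → IsFundamentalMatrix G ⁅ t ⁆ (F t)
    isFundamental t =
      (λ (s , p) (m , q) → trans (Q*F-entry G F 𝐅 𝐅≈F s m t {p} {q})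
        (trans (inverse (∉⁅⁆⇒≢ p) (∉⁅⁆⇒≢ q)) (sym (1ᵀ≈1ᴹ ⁅ t ⁆ s m)))) ,
      (λ (s , p) (m , q) → trans (F*Q-entry G F 𝐅 𝐅≈F s m t {p} {q})
        (trans (green-leftInverse G connected green (∉⁅⁆⇒≢ p) (∉⁅⁆⇒≢ q)) (sym (1ᵀ≈1ᴹ ⁅ t ⁆ s m))))

  fundamental-cong : ∀ {n} (G : Network n) {𝐅 𝐆 : Tensor n} → (∀ s m t → 𝐅 s m t ≈ 𝐆 s m t) →
    IsFundamentalTensor G 𝐆 → IsFundamentalTensor G 𝐅
  fundamental-cong G 𝐅≈𝐆 (F , isFundamental , 𝐆≈F) =
    F , isFundamental , λ s m t → trans (𝐅≈𝐆 s m t) (𝐆≈F s m t)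

-- The stationary distribution and the two pseudo-inverse formulas.

module LaplacianFormulas {c ℓ₁ ℓ₂} (K : OrderedField c ℓ₁ ℓ₂) where
  open OrderedField K hiding (zero)
  open OrderedFieldProperties K
  open RandomWalks K
  open LinearAlgebra K
  open NetworkProperties K
  open FundamentalTensors K
  open IntegerCoefficients commutativeRing using (solve; _:=_; _:+_; _:-_; _:*_; :-_)
  open SetoidReasoning setoid

  module _ {n} (G : Network n) where
    open Network G

    degree-nonneg : ∀ i → 0# ≤ degree i
    degree-nonneg i = sum-nonneg {x = affinity i} (nonneg i)

    P-nonneg : ∀ i j → 0# ≤ P i j
    P-nonneg i j with degree-nonneg i
    ... | inj₁ 0<d = ≤-trans (*-nonneg (inj₁ (⁻¹-pos 0<d)) (nonneg i j))
                             (≤-reflexive (sym (P-entry G i j)))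
    -- The inverse of a zero degree may be anything, but every affinity in the row is bounded by the
    -- degree and hence zero.
    ... | inj₂ 0≈d = ≤-reflexive (sym (trans (P-entry G i j) (trans (*-congˡ a≈0) (zeroʳ _))))
      where
      a≈0 : affinity i j ≈ 0#
      a≈0 = ≤-antisym (≤-trans (term≤sum {x = affinity i} (nonneg i) j) (≤-reflexive (sym 0≈d))) (nonneg i j)

    P-pos : ∀ {i j} → Edge i j → 0# < P i j
    P-pos {i} {j} edge = <-respʳ-≈ (sym (P-entry G i j)) (*-pos (⁻¹-pos (Edge⇒degree-pos G edge)) edge)

    module _ {π : Vector n} (stationary : IsStationary G π) where
      open IsStationary stationary renaming (nonneg to π-nonneg)

      -- The entries sum to 1, so one is positive. Invariance gives `π j ≥ π i * P i j`, which
      -- carries positivity across each edge of a path.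
      stationary-pos : StronglyConnected G → ∀ i → 0# < π i
      stationary-pos connected i with sum-pos {x = π} π-nonneg (<-respʳ-≈ (sym total) 0<1)
      ... | k , 0<πₖ = propagate 0<πₖ (connected k i)
        where
        propagate : ∀ {i j} → 0# < π i → Star Edge i j → 0# < π j
        propagate 0<πᵢ ε = 0<πᵢ
        propagate {i} 0<πᵢ (_◅_ {j = j} edge path) = propagate
          (<-respʳ-≈ (invariant j) (<-≤-trans (*-pos 0<πᵢ (P-pos edge))
            (term≤sum {x = λ k → π k * P k j} (λ k → *-nonneg (π-nonneg k) (P-nonneg k j)) i)))
          path

      stationary-randomWalkLaplacian : ∀ x → sum (λ i → π i * (randomWalkLaplacian G · x) i) ≈ 0#
      stationary-randomWalkLaplacian x = begin
        sum (λ i → π i * (Q · x) i)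
          ≈⟨ sum-cong-≋ {n} (λ i → *-distribˡ-sum {n} (π i) _) ⟩
        sum (λ i → sum (λ k → π i * (Q i k * x k)))
          ≈⟨ ∑-comm {n} {n} _ ⟩
        sum (λ k → sum (λ i → π i * (Q i k * x k)))
          ≈⟨ sum-cong-≋ {n} (λ k → sum-cong-≋ {n} (λ i → sym (*-assoc _ _ _))) ⟩
        sum (λ k → sum (λ i → π i * Q i k * x k))
          ≈⟨ sum-cong-≋ {n} (λ k → *-distribʳ-sum {n} (x k) _) ⟨
        sum (λ k → sum (λ i → π i * Q i k) * x k)
          ≈⟨ sum-zero {n} (λ k → trans (*-congʳ (πQ≈0 k)) (zeroˡ _)) ⟩
        0# ∎
        where
        Q = randomWalkLaplacian G
        πQ≈0 : ∀ k → sum (λ i → π i * Q i k) ≈ 0#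
        πQ≈0 k = begin
          sum (λ i → π i * (1ᴹ i k - P i k))
            ≈⟨ sum-cong-≋ {n} (λ i → solve 3 (λ p d q → p :* (d :- q) := p :* d :- p :* q) refl
                 (π i) (1ᴹ i k) (P i k)) ⟩
          sum (λ i → π i * 1ᴹ i k - π i * P i k)
            ≈⟨ sum-sub {n} _ _ ⟩
          sum (λ i → π i * 1ᴹ i k) - sum (λ i → π i * P i k)
            ≈⟨ +-cong (trans (sum-single k (λ i i≢k → trans (*-congˡ (diag-off _ i≢k)) (zeroʳ _)))
                             (trans (*-congˡ (diag-refl _ k)) (*-identityʳ _)))
                      (-‿cong (invariant k)) ⟩
          π k - π k
            ≈⟨ -‿inverseʳ _ ⟩
          0# ∎

  -- e = f − X (B f) lies in ker B because B X B = B, so it is constant; comparing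
  -- its values at s and t gives f s.
  solution-via-generalizedInverse : ∀ {n} {B X : Matrix {n}} → B *ᴹ X *ᴹ B ≈ᴹ B →
    (∀ {x} → (∀ i → (B · x) i ≈ 0#) → ∀ i j → x i ≈ x j) →
    ∀ {f} m t a b → f t ≈ 0# → (∀ s → (B · f) s ≈ a * 1ᴹ s m - b * 1ᴹ s t) →
    ∀ s → f s ≈ a * X s m - b * X s t - (a * X t m - b * X t t)
  solution-via-generalizedInverse {n} {B} {X} BXB≈B kernel {f} m t a b fₜ≈0 Bf s = begin
    f s
      ≈⟨ solve 3 (λ f g h → f := f :- g :- h :+ (g :+ h)) refl (f s) (g s) (f t - g t) ⟩
    f s - g s - (f t - g t) + (g s + (f t - g t))
      ≈⟨ +-congʳ (trans (+-congʳ (kernel Be≈0 s t)) (-‿inverseʳ _)) ⟩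
    0# + (g s + (f t - g t))
      ≈⟨ trans (+-identityˡ _) (+-congˡ (trans (+-congʳ fₜ≈0) (+-identityˡ _))) ⟩
    g s - g t
      ≈⟨ +-cong (g-entry s) (-‿cong (g-entry t)) ⟩
    a * X s m - b * X s t - (a * X t m - b * X t t) ∎
    where
    g : Vector n
    g = X · (B · f)
    Be≈0 : ∀ i → (B · (λ k → f k - g k)) i ≈ 0#
    Be≈0 i = begin
      (B · (λ k → f k - g k)) i            ≈⟨ ·-sub B f g i ⟩
      (B · f) i - (B · (X · (B · f))) i    ≈⟨ +-congˡ (-‿cong (*ᴹ-· B X (B · f) i)) ⟨
      (B · f) i - ((B *ᴹ X) · (B · f)) i   ≈⟨ +-congˡ (-‿cong (*ᴹ-· (B *ᴹ X) B f i)) ⟨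
      (B · f) i - ((B *ᴹ X *ᴹ B) · f) i
        ≈⟨ +-congˡ (-‿cong (sum-cong-≋ {n} (λ k → *-congʳ (BXB≈B i k)))) ⟩
      (B · f) i - (B · f) i                ≈⟨ -‿inverseʳ _ ⟩
      0#                                   ∎
    g-entry : ∀ i → g i ≈ a * X i m - b * X i t
    g-entry i = begin
      (X · (B · f)) i
        ≈⟨ ·-cong X Bf i ⟩
      (X · (λ k → a * 1ᴹ k m - b * 1ᴹ k t)) i
        ≈⟨ ·-sub X (λ k → a * 1ᴹ k m) (λ k → b * 1ᴹ k t) i ⟩
      (X · (λ k → a * 1ᴹ k m)) i - (X · (λ k → b * 1ᴹ k t)) i
        ≈⟨ +-cong (trans (·-scale X a (flip 1ᴹ m) i) (*-congˡ (·-basis X i m)))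
                  (-‿cong (trans (·-scale X b (flip 1ᴹ t) i) (*-congˡ (·-basis X i t)))) ⟩
      a * X i m - b * X i t ∎

  module _ {n} {G : Network n} (connected : StronglyConnected G)
           {π : Vector n} (stationary : IsStationary G π)
           {𝐅 : Tensor n} (green : IsGreenTensor G 𝐅) where
    open IsGreenTensor green

    private
      Q = randomWalkLaplacian G
      0<π = stationary-pos G stationary connected

      π≉0 : ∀ i → ¬ π i ≈ 0#
      π≉0 i = pos⇒≉0 (0<π i)

      ratio-cancel : ∀ m t → π m / π t * π t ≈ π m
      ratio-cancel m t = trans (*-assoc _ _ _) (trans (*-congˡ (⁻¹-inverseˡ (π≉0 t))) (*-identityʳ _))

    -- Off t this is the defining equation of 𝐅; the value at t is forced by π Q = 0.
    randomWalkLaplacian-column : ∀ {m t} → m ≢ t → ∀ s →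
      (Q · (λ k → 𝐅 k m t)) s ≈ 1# * 1ᴹ s m - π m / π t * 1ᴹ s t
    randomWalkLaplacian-column {m} {t} m≢t s = on-or-off (s Fin.≟ t)
      where
      r = π m / π t
      h e : Vector n
      h = Q · (λ k → 𝐅 k m t)
      e k = 1# * 1ᴹ k m - r * 1ᴹ k t
      off : ∀ {k} → k ≢ t → h k ≈ e k
      off {k} k≢t = begin
        h k                    ≈⟨ inverse k≢t m≢t ⟩
        -- Zero is written as a difference so that it can be replaced by the vanishing entry
        -- `1ᴹ k t`. The same device recurs below.
        1ᴹ k m                 ≈⟨ solve 2 (λ w r → w := w :- r :* (w :- w)) refl (1ᴹ k m) r ⟩
        1ᴹ k m - r * (1ᴹ k m - 1ᴹ k m)
          ≈⟨ +-cong (sym (*-identityˡ _)) (-‿cong (*-congˡ (trans (-‿inverseʳ _) (sym (diag-off _ k≢t))))) ⟩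
        e k                    ∎
      -- This fixes the coefficient `π m / π t`: every image under `Q` is orthogonal to `π`, so the
      -- right-hand side must be too. As `h` and `e` agree off `t`, orthogonality leaves only
      -- `π t * (h t - e t)`, which must vanish.
      πe≈0 : sum (λ k → π k * e k) ≈ 0#
      πe≈0 = begin
        sum (λ k → π k * e k)
          ≈⟨ sum-cong-≋ {n} (λ k → solve 5 (λ p o w r v → p :* (o :* w :- r :* v) := w :* (o :* p) :- v :* (r :* p)) refl
               (π k) 1# (1ᴹ k m) r (1ᴹ k t)) ⟩
        sum (λ k → 1ᴹ k m * (1# * π k) - 1ᴹ k t * (r * π k))
          ≈⟨ sum-sub {n} _ _ ⟩
        sum (λ k → 1ᴹ k m * (1# * π k)) - sum (λ k → 1ᴹ k t * (r * π k))
          ≈⟨ +-cong (pick m (λ k → 1# * π k)) (-‿cong (pick t (λ k → r * π k))) ⟩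
        1# * π m - r * π t
          ≈⟨ +-cong (*-identityˡ _) (-‿cong (ratio-cancel m t)) ⟩
        π m - π m
          ≈⟨ -‿inverseʳ _ ⟩
        0# ∎
        where
        pick : ∀ j (x : Vector n) → sum (λ k → 1ᴹ k j * x k) ≈ x j
        pick j x = trans
          (sum-single j (λ k k≢j → trans (*-congʳ (diag-off _ k≢j)) (zeroˡ _)))
          (trans (*-congʳ (diag-refl _ j)) (*-identityˡ _))
      on : h t ≈ e t
      on = -≈0⇒≈ (*-cancelˡ (π≉0 t) (begin
        π t * (h t - e t)
          ≈⟨ sum-single t (λ k k≢t → trans (*-congˡ (trans (+-congʳ (off k≢t)) (-‿inverseʳ _))) (zeroʳ _)) ⟨
        sum (λ k → π k * (h k - e k))
          ≈⟨ sum-cong-≋ {n} (λ k → solve 3 (λ p x y → p :* (x :- y) := p :* x :- p :* y) refl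
               (π k) (h k) (e k)) ⟩
        sum (λ k → π k * h k - π k * e k)
          ≈⟨ sum-sub {n} _ _ ⟩
        sum (λ k → π k * h k) - sum (λ k → π k * e k)
          ≈⟨ +-cong (stationary-randomWalkLaplacian G stationary _) (-‿cong πe≈0) ⟩
        0# - 0#
          ≈⟨ -‿inverseʳ 0# ⟩
        0#
          ≈⟨ zeroʳ _ ⟨
        π t * 0# ∎))
      on-or-off : Dec (s ≡ t) → h s ≈ e s
      on-or-off (yes ≡.refl) = on
      on-or-off (no s≢t)     = off s≢t

    digraphLaplacian-· : ∀ x i → (digraphLaplacian G π · x) i ≈ π i * (Q · x) i
    digraphLaplacian-· x i = trans (*ᴹ-· (diag π) Q x i) (diag-· π (Q · x) i)

    -- Scaling row `s` by `π s` turns the coefficients 1 and `π m / π t` of the column equation into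
    -- the same number `π m`, which therefore factors out. The case `m = t` is separate because the
    -- column equation fails there: the column is zero and both sides vanish.
    digraphLaplacian-formula : ∀ {L⁺} → IsMoorePenrose (digraphLaplacian G π) L⁺ →
      ∀ s m t → 𝐅 s m t ≈ (L⁺ s m - L⁺ t m + L⁺ t t - L⁺ s t) * π m
    digraphLaplacian-formula {L⁺} mp s m t with m Fin.≟ t
    ... | yes ≡.refl = begin
      𝐅 s t t   ≈⟨ at-target s t ⟩
      0#        ≈⟨ -‿inverseʳ (π t) ⟨
      π t - π t
        ≈⟨ solve 3 (λ x y p → p :- p := (x :- y :+ y :- x) :* p) refl (L⁺ s t) (L⁺ t t) (π t) ⟩
      (L⁺ s t - L⁺ t t + L⁺ t t - L⁺ s t) * π t ∎
    ... | no m≢t = begin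
      𝐅 s m t
        ≈⟨ solution-via-generalizedInverse (IsMoorePenrose.MXM≈M mp) kernel m t (π m) (π m)
             (from-target m t) column s ⟩
      π m * L⁺ s m - π m * L⁺ s t - (π m * L⁺ t m - π m * L⁺ t t)
        ≈⟨ solve 5 (λ p a b c d → p :* a :- p :* b :- (p :* c :- p :* d) := (a :- c :+ d :- b) :* p) refl
             (π m) (L⁺ s m) (L⁺ s t) (L⁺ t m) (L⁺ t t) ⟩
      (L⁺ s m - L⁺ t m + L⁺ t t - L⁺ s t) * π m ∎
      where
      kernel : ∀ {x} → (∀ i → (digraphLaplacian G π · x) i ≈ 0#) → ∀ i j → x i ≈ x j
      kernel {x} Lx≈0 = randomWalkLaplacian-kernel G connected (λ i → *-cancelˡ (π≉0 i)
        (trans (sym (digraphLaplacian-· x i)) (trans (Lx≈0 i) (sym (zeroʳ _)))))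
      column : ∀ s → (digraphLaplacian G π · (λ k → 𝐅 k m t)) s ≈ π m * 1ᴹ s m - π m * 1ᴹ s t
      column s = begin
        (digraphLaplacian G π · (λ k → 𝐅 k m t)) s
          ≈⟨ digraphLaplacian-· _ s ⟩
        π s * (Q · (λ k → 𝐅 k m t)) s
          ≈⟨ *-congˡ (randomWalkLaplacian-column m≢t s) ⟩
        π s * (1# * 1ᴹ s m - π m / π t * 1ᴹ s t)
          ≈⟨ solve 5 (λ p o w r v → p :* (o :* w :- r :* v) := o :* (p :* w) :- r :* (p :* v)) refl
               (π s) 1# (1ᴹ s m) (π m / π t) (1ᴹ s t) ⟩
        1# * (π s * 1ᴹ s m) - π m / π t * (π s * 1ᴹ s t)
          ≈⟨ +-cong (trans (*-identityˡ _) (weight-basis π s m))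
                    (-‿cong (trans (*-congˡ (weight-basis π s t))
                      (trans (sym (*-assoc _ _ _)) (*-congʳ (ratio-cancel m t))))) ⟩
        π m * 1ᴹ s m - π m * 1ᴹ s t ∎

    randomWalkLaplacian-formula : ∀ {Lᵖ⁺} → IsMoorePenrose Q Lᵖ⁺ →
      ∀ s m t → 𝐅 s m t ≈ Lᵖ⁺ s m - Lᵖ⁺ t m + (π m / π t) * Lᵖ⁺ t t - (π m / π t) * Lᵖ⁺ s t
    randomWalkLaplacian-formula {Lᵖ⁺} mp s m t with m Fin.≟ t
    ... | yes ≡.refl = begin
      𝐅 s t t
        ≈⟨ at-target s t ⟩
      0#
        ≈⟨ -‿inverseʳ 0# ⟨
      0# - 0#
        ≈⟨ solve 3 (λ x y z → z :- z := x :- y :+ y :- x) refl (Lᵖ⁺ s t) (Lᵖ⁺ t t) 0# ⟩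
      Lᵖ⁺ s t - Lᵖ⁺ t t + Lᵖ⁺ t t - Lᵖ⁺ s t
        ≈⟨ +-cong (+-congˡ (unit (Lᵖ⁺ t t))) (-‿cong (unit (Lᵖ⁺ s t))) ⟩
      Lᵖ⁺ s t - Lᵖ⁺ t t + (π t / π t) * Lᵖ⁺ t t - (π t / π t) * Lᵖ⁺ s t ∎
      where
      unit : ∀ x → x ≈ (π t / π t) * x
      unit x = sym (trans (*-congʳ (⁻¹-inverseʳ (π≉0 t))) (*-identityˡ x))
    ... | no m≢t = begin
      𝐅 s m t
        ≈⟨ solution-via-generalizedInverse (IsMoorePenrose.MXM≈M mp) (randomWalkLaplacian-kernel G connected)
             m t 1# (π m / π t) (from-target m t) (randomWalkLaplacian-column m≢t) s ⟩
      1# * Lᵖ⁺ s m - r * Lᵖ⁺ s t - (1# * Lᵖ⁺ t m - r * Lᵖ⁺ t t)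
        ≈⟨ +-cong (+-congʳ (*-identityˡ _)) (-‿cong (+-congʳ (*-identityˡ _))) ⟩
      Lᵖ⁺ s m - r * Lᵖ⁺ s t - (Lᵖ⁺ t m - r * Lᵖ⁺ t t)
        ≈⟨ solve 5 (λ r a b c d → a :- r :* b :- (c :- r :* d) := a :- c :+ r :* d :- r :* b) refl
             r (Lᵖ⁺ s m) (Lᵖ⁺ s t) (Lᵖ⁺ t m) (Lᵖ⁺ t t) ⟩
      Lᵖ⁺ s m - Lᵖ⁺ t m + r * Lᵖ⁺ t t - r * Lᵖ⁺ s t ∎
      where r = π m / π t

-- Column reduction of the graph Laplacian.

module Elimination {c ℓ₁ ℓ₂} (K : OrderedField c ℓ₁ ℓ₂) where
  open OrderedField K hiding (zero)
  open OrderedFieldProperties K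
  open RandomWalks K
  open LinearAlgebra K
  open NetworkProperties K
  open FundamentalTensors K
  open RingProperties ring using (-0#≈0#)
  open IntegerCoefficients commutativeRing using (solve; _:=_; _:+_; _:-_; _:*_; :-_)
  open SetoidReasoning setoid

  -- The column operation that turns row p of Y into the unit vector eₚ,
  -- applied to B.
  eliminate : ∀ {n} → Fin n → (Y B : Matrix {n}) → Matrix {n}
  eliminate p Y B i j = B i j - B i p * ((Y p j - 1ᴹ p j) / Y p p)

  -- The subtracted multiple of column `p` has no entry in such a row. This protects both the rows
  -- of `Y` already solved and the rows of `X` not yet touched.
  eliminate-fixes : ∀ {n} p (Y B : Matrix {n}) i → B i p ≈ 0# → ∀ j → eliminate p Y B i j ≈ B i j
  eliminate-fixes p Y B i Bᵢₚ≈0 j = trans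
    (+-congˡ (trans (-‿cong (trans (*-congʳ Bᵢₚ≈0) (zeroˡ _))) -0#≈0#))
    (+-identityʳ _)

  module _ {n} (G : Network n) (connected : StronglyConnected G) (root : Fin n) where
    open Network G

    private
      M = graphLaplacian G

    -- The loop invariant; `rest` lists the nodes still to be visited. The unit rows of `X` at
    -- pending nodes make the next pivot provably nonzero: column `p` of `X` is 1 at `p` and 0 at
    -- the root and at all other pending nodes.
    record Reduced (rest : List (Fin n)) (X Y : Matrix {n}) : Set ℓ₁ where
      field
        image     : ∀ i j → Y i j ≈ (M · flip X j) i
        solved    : ∀ {i} → i ∉ˡ rest → i ≢ root → ∀ j → Y i j ≈ 1ᴹ i j
        untouched : ∀ {i} → i ∈ˡ rest ⊎ i ≡ root → ∀ j → X i j ≈ 1ᴹ i j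

    reduced-initial : Reduced (allFin n) 1ᴹ M
    reduced-initial = record
      { image     = λ i j → sym (·-basis M i j)
      ; solved    = λ i∉ → contradiction (∈-allFin _) i∉
      ; untouched = λ _ _ → refl
      }

    -- The root gets no pivot: `M` kills the constants, so `M X` can never be the identity and one
    -- row has to stay unsolved.
    reduced-skip : ∀ {rest X Y} → Reduced (root ∷ rest) X Y → Reduced rest X Y
    reduced-skip red = record
      { image     = image
      ; solved    = λ i∉rest i≢root → solved
          (λ { (here i≡root) → i≢root i≡root ; (there i∈rest) → i∉rest i∈rest }) i≢root
      ; untouched = λ i∈ → untouched (Sum.map₁ there i∈)
      } where open Reduced red

    module _ {p rest X Y} (red : Reduced (p ∷ rest) X Y) (p≢root : p ≢ root) where
      open Reduced red

      -- With a zero pivot, column `p` of `X` would be harmonic except at the root and the other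
      -- pending nodes, where it is 0. Uniqueness would make it zero everywhere, but its entry at
      -- `p` is 1.
      pivot≉0 : ¬ Y p p ≈ 0#
      pivot≉0 Yₚₚ≈0 = 0≉1 (begin
        0#        ≈⟨ Xᵣₚ≈0 ⟨
        X root p  ≈⟨ dirichlet-uniqueness G connected {flip X p} root harmonic p ⟨
        X p p     ≈⟨ untouched (inj₁ (here ≡.refl)) p ⟩
        1ᴹ p p    ≈⟨ diag-refl _ p ⟩
        1#        ∎)
        where
        open DecMembership Fin._≟_ renaming (_∈?_ to _∈ˡ?_)
        Xᵣₚ≈0 : X root p ≈ 0#
        Xᵣₚ≈0 = trans (untouched (inj₂ ≡.refl) p) (diag-off _ (p≢root ∘ ≡.sym))
        harmonic : ∀ i → X i p ≈ X root p ⊎ (M · flip X p) i ≈ 0#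
        harmonic i with i Fin.≟ p | i ∈ˡ? rest | i Fin.≟ root
        ... | yes ≡.refl | _          | _          = inj₂ (trans (sym (image p p)) Yₚₚ≈0)
        ... | no _       | _          | yes ≡.refl = inj₁ refl
        ... | no i≢p     | yes i∈rest | no _       = inj₁
          (trans (untouched (inj₁ (there i∈rest)) p) (trans (diag-off _ i≢p) (sym Xᵣₚ≈0)))
        ... | no i≢p     | no i∉rest  | no i≢root  = inj₂
          (trans (sym (image i p)) (trans
            (solved (λ { (here i≡p) → i≢p i≡p ; (there i∈rest) → i∉rest i∈rest }) i≢root p)
            (diag-off _ i≢p)))

      reduced-eliminate : p ∉ˡ rest → Reduced rest (eliminate p Y X) (eliminate p Y Y)
      reduced-eliminate p∉rest = record
        { image     = λ i j → let k = (Y p j - 1ᴹ p j) / Y p p in begin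
            Y i j - Y i p * k
              ≈⟨ +-cong (image i j) (-‿cong (trans (*-congʳ (image i p)) (*-comm _ _))) ⟩
            (M · flip X j) i - k * (M · flip X p) i
              ≈⟨ +-congˡ (-‿cong (·-scale M k (flip X p) i)) ⟨
            (M · flip X j) i - (M · (λ l → k * X l p)) i
              ≈⟨ ·-sub M (flip X j) (λ l → k * X l p) i ⟨
            (M · (λ l → X l j - k * X l p)) i
              ≈⟨ ·-cong M (λ l → +-congˡ (-‿cong (*-comm _ _))) i ⟩
            (M · flip (eliminate p Y X) j) i ∎
        ; solved    = solved′
        ; untouched = untouched′
        }
        where
        pivot-row : ∀ j → eliminate p Y Y p j ≈ 1ᴹ p j
        pivot-row j = begin
          Y p j - Y p p * ((Y p j - 1ᴹ p j) * Y p p ⁻¹)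
            ≈⟨ solve 4 (λ y v d i → y :- v :* ((y :- d) :* i) := y :- (v :* i) :* (y :- d)) refl
                 (Y p j) (Y p p) (1ᴹ p j) (Y p p ⁻¹) ⟩
          Y p j - Y p p * Y p p ⁻¹ * (Y p j - 1ᴹ p j)
            ≈⟨ +-congˡ (-‿cong (trans (*-congʳ (⁻¹-inverseʳ pivot≉0)) (*-identityˡ _))) ⟩
          Y p j - (Y p j - 1ᴹ p j)
            ≈⟨ solve 2 (λ y d → y :- (y :- d) := d) refl (Y p j) (1ᴹ p j) ⟩
          1ᴹ p j ∎
        solved′ : ∀ {i} → i ∉ˡ rest → i ≢ root → ∀ j → eliminate p Y Y i j ≈ 1ᴹ i j
        solved′ {i} i∉rest i≢root j with i Fin.≟ p
        ... | yes ≡.refl = pivot-row j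
        ... | no i≢p = trans (eliminate-fixes p Y Y i (trans (row p) (diag-off _ i≢p)) j) (row j)
          where
          row : ∀ j → Y i j ≈ 1ᴹ i j
          row = solved (λ { (here i≡p) → i≢p i≡p ; (there i∈rest) → i∉rest i∈rest }) i≢root
        untouched′ : ∀ {i} → i ∈ˡ rest ⊎ i ≡ root → ∀ j → eliminate p Y X i j ≈ 1ᴹ i j
        untouched′ {i} i∈ j = trans (eliminate-fixes p Y X i (trans (row p) (diag-off _ (i≢p i∈))) j) (row j)
          where
          row : ∀ j → X i j ≈ 1ᴹ i j
          row = untouched (Sum.map₁ there i∈)
          i≢p : i ∈ˡ rest ⊎ i ≡ root → i ≢ p
          i≢p (inj₁ i∈rest) ≡.refl = p∉rest i∈rest
          i≢p (inj₂ ≡.refl) ≡.refl = p≢root ≡.refl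

    module _ {X Y} (red : Reduced [] X Y) where
      open Reduced red

      -- The left null vector of `M`, scaled to 1 at the root: if `y M = 0`, pairing `y` with the
      -- equation of column `m` gives `y m = weight m * y root`. When the degrees are positive,
      -- `degree m * weight m` is thus proportional to the stationary probability of `m`.
      weight : Fin n → Carrier
      weight m = 1ᴹ root m - Y root m

      graphLaplacian-column : ∀ m i → (M · flip X m) i ≈ 1ᴹ i m - weight m * 1ᴹ i root
      graphLaplacian-column m i = trans (sym (image i m)) (by-row (i Fin.≟ root))
        where
        by-row : Dec (i ≡ root) → Y i m ≈ 1ᴹ i m - weight m * 1ᴹ i root
        by-row (yes ≡.refl) = begin
          Y i m
            ≈⟨ solve 2 (λ y d → y := d :- (d :- y)) refl (Y i m) (1ᴹ i m) ⟩
          1ᴹ i m - weight m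
            ≈⟨ +-congˡ (-‿cong (trans (*-congˡ (diag-refl _ i)) (*-identityʳ _))) ⟨
          1ᴹ i m - weight m * 1ᴹ i i       ∎
        by-row (no i≢root) = begin
          Y i m                             ≈⟨ solved (λ ()) i≢root m ⟩
          1ᴹ i m
            ≈⟨ solve 2 (λ d w → d := d :- w :* (d :- d)) refl (1ᴹ i m) (weight m) ⟩
          1ᴹ i m - weight m * (1ᴹ i m - 1ᴹ i m)
            ≈⟨ +-congˡ (-‿cong (*-congˡ (trans (-‿inverseʳ _) (sym (diag-off _ i≢root))))) ⟩
          1ᴹ i m - weight m * 1ᴹ i root     ∎

      -- If weight t vanished, column t of X would be superharmonic on the whole
      -- network, hence constant, although M maps it to eₜ.
      weight≉0 : ∀ t → ¬ weight t ≈ 0#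
      weight≉0 t w≈0 = 0≉1 (begin
        0#                ≈⟨ graphLaplacian-const G const t ⟨
        (M · flip X t) t  ≈⟨ Mx≈e t ⟩
        1ᴹ t t            ≈⟨ diag-refl _ t ⟩
        1#                ∎)
        where
        Mx≈e : ∀ i → (M · flip X t) i ≈ 1ᴹ i t
        Mx≈e i = begin
          (M · flip X t) i                ≈⟨ graphLaplacian-column t i ⟩
          1ᴹ i t - weight t * 1ᴹ i root   ≈⟨ +-congˡ (-‿cong (*-congʳ w≈0)) ⟩
          1ᴹ i t - 0# * 1ᴹ i root
            ≈⟨ +-congˡ (-‿cong (trans (zeroˡ _) (sym (-‿inverseʳ (1ᴹ i t))))) ⟩
          1ᴹ i t - (1ᴹ i t - 1ᴹ i t)      ≈⟨ solve 1 (λ d → d :- (d :- d) := d) refl (1ᴹ i t) ⟩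
          1ᴹ i t                          ∎
        1ᴹ-nonneg : ∀ i → 0# ≤ 1ᴹ i t
        1ᴹ-nonneg i with does (i Fin.≟ t)
        ... | Bool.true  = inj₁ 0<1
        ... | Bool.false = ≤-reflexive refl
        least : ∀ r i → X r t ≤ X i t
        least r = minimum-principle G connected {flip X t} r
          (λ i → inj₂ (≤-trans (1ᴹ-nonneg i) (≤-reflexive (sym (Mx≈e i)))))
        const : ∀ i j → X i t ≈ X j t
        const i j = ≤-antisym (least i j) (least j i)

      -- The ratio of weights cancels the multiples of the unit vector at the root in columns `m`
      -- and `t`. Subtracting the values at `t`, which changes `X` only by constants, enforces the
      -- boundary condition, and `degree m` converts an equation for `M` into one for `I − P`.
      green : Tensor n
      green s m t = degree m * ((X s m - X t m) - weight m / weight t * (X s t - X t t))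

      green-isGreenTensor : IsGreenTensor G green
      green-isGreenTensor = record
        { from-target = λ m t → begin
            green t m t
              ≈⟨ solve 4 (λ d x q y → d :* ((x :- x) :- q :* (y :- y)) := d :- d) refl
                   (degree m) (X t m) (weight m / weight t) (X t t) ⟩
            degree m - degree m
              ≈⟨ -‿inverseʳ _ ⟩
            0# ∎
        ; at-target = λ s t → begin
            degree t * ((X s t - X t t) - weight t / weight t * (X s t - X t t))
              ≈⟨ *-congˡ (+-congˡ (-‿cong (trans (*-congʳ (⁻¹-inverseʳ (weight≉0 t))) (*-identityˡ _)))) ⟩
            degree t * ((X s t - X t t) - (X s t - X t t))
              ≈⟨ trans (*-congˡ (-‿inverseʳ _)) (zeroʳ _) ⟩
            0# ∎
        ; inverse = λ {s} {m} {t} s≢t m≢t → *-cancelˡ (pos⇒≉0 (degree-pos G connected s≢t)) (begin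
            degree s * (randomWalkLaplacian G · (λ k → green k m t)) s
              ≈⟨ degree*randomWalkLaplacian G (degree-pos G connected s≢t) _ ⟩
            (M · (λ k → green k m t)) s
              ≈⟨ M-green s m t ⟩
            degree m * (1ᴹ s m - weight m / weight t * 1ᴹ s t)
              ≈⟨ *-congˡ (+-congˡ (-‿cong (*-congˡ (trans (diag-off _ s≢t) (sym (-‿inverseʳ (1ᴹ s m))))))) ⟩
            degree m * (1ᴹ s m - weight m / weight t * (1ᴹ s m - 1ᴹ s m))
              ≈⟨ solve 3 (λ d w q → d :* (w :- q :* (w :- w)) := d :* w) refl
                   (degree m) (1ᴹ s m) (weight m / weight t) ⟩
            degree m * 1ᴹ s m
              ≈⟨ weight-basis degree s m ⟨
            degree s * 1ᴹ s m ∎)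
        }
        where
        M-green : ∀ s m t → (M · (λ k → green k m t)) s ≈ degree m * (1ᴹ s m - weight m / weight t * 1ᴹ s t)
        M-green s m t = begin
          (M · (λ k → green k m t)) s
            ≈⟨ ·-scale M (degree m) _ s ⟩
          degree m * (M · (λ k → (X k m - X t m) - q * (X k t - X t t))) s
            ≈⟨ *-congˡ (·-sub M _ _ s) ⟩
          degree m * ((M · (λ k → X k m - X t m)) s - (M · (λ k → q * (X k t - X t t))) s)
            ≈⟨ *-congˡ (+-cong (shift m) (-‿cong (trans (·-scale M q _ s) (*-congˡ (shift t))))) ⟩
          degree m * (e m - q * e t)
            ≈⟨ solve 7 (λ d a w r q b v → d :* ((a :- w :* r) :- q :* (b :- v :* r)) :=
                 d :* ((a :- q :* b) :+ (q :* v :- w) :* r)) refl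
                 (degree m) (1ᴹ s m) (weight m) (1ᴹ s root) q (1ᴹ s t) (weight t) ⟩
          degree m * ((1ᴹ s m - q * 1ᴹ s t) + (q * weight t - weight m) * 1ᴹ s root)
            ≈⟨ *-congˡ (+-congˡ (trans (*-congʳ qw-w≈0) (zeroˡ _))) ⟩
          degree m * ((1ᴹ s m - q * 1ᴹ s t) + 0#)
            ≈⟨ *-congˡ (+-identityʳ _) ⟩
          degree m * (1ᴹ s m - q * 1ᴹ s t) ∎
          where
          q = weight m / weight t
          e : Fin n → Carrier
          e j = 1ᴹ s j - weight j * 1ᴹ s root
          shift : ∀ j → (M · (λ k → X k j - X t j)) s ≈ e j
          shift j = begin
            (M · (λ k → X k j - X t j)) s
              ≈⟨ ·-sub M (flip X j) (λ _ → X t j) s ⟩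
            (M · flip X j) s - (M · (λ _ → X t j)) s
              ≈⟨ +-cong (graphLaplacian-column j s)
                     (-‿cong (trans (graphLaplacian-const G (λ _ _ → refl) s) (sym (-‿inverseʳ (e j))))) ⟩
            e j - (e j - e j)
              ≈⟨ solve 1 (λ d → d :- (d :- d) := d) refl (e j) ⟩
            e j ∎
          qw-w≈0 : q * weight t - weight m ≈ 0#
          qw-w≈0 = trans (+-congʳ (trans (*-assoc _ _ _)
            (trans (*-congˡ (⁻¹-inverseˡ (weight≉0 t))) (*-identityʳ _)))) (-‿inverseʳ _)

-- A syntactic bound on step counts.

coefficient : ∀ {k} → Command k → ℕ
coefficient skip           = 1
coefficient (_ [ xs ]≔ e)  = 1 ℕ.+ (length xs ℕ.+ steps e)
coefficient (p ⨾ q)        = 1 ℕ.+ (coefficient p ℕ.+ coefficient q)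
coefficient (branch _ p q) = 1 ℕ.+ (coefficient p ℕ.+ coefficient q)
coefficient (for p)        = 1 ℕ.+ coefficient p

depth : ∀ {k} → Command k → ℕ
depth skip           = 0
depth (_ [ _ ]≔ _)   = 0
depth (p ⨾ q)        = depth p ℕ.⊔ depth q
depth (branch _ p q) = depth p ℕ.⊔ depth q
depth (for p)        = suc (depth p)

module Cost {c ℓ₁ ℓ₂} (K : OrderedField c ℓ₁ ℓ₂) where
  open Execution K
  open ℕ.≤-Reasoning

  -- The base is `suc n` because a loop costs one step even when `n` is 0; every power of it is at
  -- least 1, so additive overheads are absorbed into the coefficient.
  bound : ∀ {k} → ℕ → Command k → ℕ
  bound n p = coefficient p ℕ.* suc n ℕ.^ depth p

  private
    1≤power : ∀ n d → 1 ℕ.≤ suc n ℕ.^ d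
    1≤power n d = ℕ.m^n>0 (suc n) d

    bound-∨ : ∀ {k} n (p q : Command k) {d} → depth p ℕ.≤ d → depth q ℕ.≤ d →
      1 ℕ.+ (bound n p ℕ.+ bound n q) ℕ.≤ (1 ℕ.+ (coefficient p ℕ.+ coefficient q)) ℕ.* suc n ℕ.^ d
    bound-∨ n p q {d} p≤d q≤d = begin
      1 ℕ.+ (bound n p ℕ.+ bound n q)
        ≤⟨ ℕ.+-mono-≤ (1≤power n d) (ℕ.+-mono-≤
             (ℕ.*-monoʳ-≤ (coefficient p) (ℕ.^-monoʳ-≤ (suc n) p≤d))
             (ℕ.*-monoʳ-≤ (coefficient q) (ℕ.^-monoʳ-≤ (suc n) q≤d))) ⟩
      N ℕ.+ (coefficient p ℕ.* N ℕ.+ coefficient q ℕ.* N)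
        ≡⟨ ≡.cong (N ℕ.+_) (ℕ.*-distribʳ-+ N (coefficient p) (coefficient q)) ⟨
      (1 ℕ.+ (coefficient p ℕ.+ coefficient q)) ℕ.* N ∎
      where N = suc n ℕ.^ d

    -- Entering the loop is charged as one more iteration, which gives the factor `suc n`. The
    -- overhead of an iteration raises the coefficient of the body by one.
    bound-for : ∀ {k} n (p : Command (suc k)) → 1 ℕ.+ n ℕ.* (1 ℕ.+ bound n p) ℕ.≤ bound n (for p)
    bound-for n p = begin
      1 ℕ.+ n ℕ.* (1 ℕ.+ bound n p)
        ≤⟨ ℕ.+-mono-≤ (ℕ.≤-trans (1≤power n d) (ℕ.m≤m+n _ _)) (ℕ.*-monoʳ-≤ n (ℕ.+-monoˡ-≤ _ (1≤power n d))) ⟩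
      suc n ℕ.* (suc C ℕ.* N)
        ≡⟨ ℕ.*-assoc (suc n) (suc C) N ⟨
      suc n ℕ.* suc C ℕ.* N
        ≡⟨ ≡.cong (ℕ._* N) (ℕ.*-comm (suc n) (suc C)) ⟩
      suc C ℕ.* suc n ℕ.* N
        ≡⟨ ℕ.*-assoc (suc C) (suc n) N ⟩
      suc C ℕ.* (suc n ℕ.* N) ∎
      where
      C = coefficient p
      d = depth p
      N = suc n ℕ.^ d

  mutual
    steps≤bound : ∀ {n k} {ρ : Vec (Fin n) k} {p σ τ σ′} → ρ ⊢⟨ p , σ ⟩⇓[ τ ] σ′ → τ ℕ.≤ bound n p
    steps≤bound skip = ℕ.≤-refl
    steps≤bound (assign _) = ℕ.≤-reflexive (≡.sym (ℕ.*-identityʳ _))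
    steps≤bound {n} (seq {p} {q} dp dq) = ℕ.≤-trans
      (ℕ.s≤s (ℕ.+-mono-≤ (steps≤bound dp) (steps≤bound dq)))
      (bound-∨ n p q (ℕ.m≤m⊔n _ _) (ℕ.m≤n⊔m _ _))
    steps≤bound {n} (ifᵗ {p = p} {q} _ dp) = ℕ.≤-trans
      (ℕ.s≤s (ℕ.≤-trans (steps≤bound dp) (ℕ.m≤m+n _ (bound n q))))
      (bound-∨ n p q (ℕ.m≤m⊔n _ _) (ℕ.m≤n⊔m _ _))
    steps≤bound {n} (ifᶠ {p = p} {q} _ dq) = ℕ.≤-trans
      (ℕ.s≤s (ℕ.≤-trans (steps≤bound dq) (ℕ.m≤n+m _ (bound n p))))
      (bound-∨ n p q (ℕ.m≤m⊔n _ _) (ℕ.m≤n⊔m _ _))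
    steps≤bound {n} (for {p} dp) = ℕ.≤-trans
      (ℕ.s≤s (ℕ.≤-trans (loop-steps≤ dp)
        (ℕ.≤-reflexive (≡.cong (ℕ._* (1 ℕ.+ bound n p)) (length-tabulate {n = n} (λ i → i))))))
      (bound-for n p)

    loop-steps≤ : ∀ {n k} {ρ : Vec (Fin n) k} {p is σ τ σ′} →
      ρ ⊢⟨for p ∈ is , σ ⟩⇓[ τ ] σ′ → τ ℕ.≤ length is ℕ.* (1 ℕ.+ bound n p)
    loop-steps≤ done         = ℕ.z≤n
    loop-steps≤ (next dp ds) = ℕ.s≤s (ℕ.+-mono-≤ (steps≤bound dp) (loop-steps≤ ds))

^-distribʳ-* : ∀ m n d → (m ℕ.* n) ℕ.^ d ≡ m ℕ.^ d ℕ.* n ℕ.^ d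
^-distribʳ-* m n zero    = ≡.refl
^-distribʳ-* m n (suc d) = ≡.trans (≡.cong (m ℕ.* n ℕ.*_) (^-distribʳ-* m n d))
                                   (ℕ.[m*n]*[o*p]≡[m*o]*[n*p] m n (m ℕ.^ d) (n ℕ.^ d))

shifted-power-∈O : ∀ C d → (λ n → C ℕ.* suc n ℕ.^ d) ∈O (λ n → n ℕ.^ d)
-- From `n = 1` on, `suc n` is at most `2 * n`; hence the threshold 1 and the factor `2 ^ d`.
shifted-power-∈O C d = C ℕ.* 2 ℕ.^ d , 1 , λ n 1≤n → begin
  C ℕ.* suc n ℕ.^ d             ≤⟨ ℕ.*-monoʳ-≤ C (ℕ.^-monoˡ-≤ d (ℕ.+-mono-≤ 1≤n (ℕ.m≤m+n n 0))) ⟩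
  C ℕ.* (2 ℕ.* n) ℕ.^ d         ≡⟨ ≡.cong (C ℕ.*_) (^-distribʳ-* 2 n d) ⟩
  C ℕ.* (2 ℕ.^ d ℕ.* n ℕ.^ d)   ≡⟨ ℕ.*-assoc C (2 ℕ.^ d) (n ℕ.^ d) ⟨
  C ℕ.* 2 ℕ.^ d ℕ.* n ℕ.^ d     ∎
  where open ℕ.≤-Reasoning

-- Program logic: total correctness, loop invariants and array filling.

Fresh : ∀ {k} → ℕ → Exp k → Set
Fresh r `0         = ⊤
Fresh r `1         = ⊤
-- A Boolean test on numerals: for a concrete expression, freshness computes to a product of unit
-- types and is inferred.
Fresh r (r′ [ _ ]) = Bool.T (Bool.not (r′ ℕ.≡ᵇ r))
Fresh r (d ⊕ e)    = Fresh r d × Fresh r e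
Fresh r (d ⊖ e)    = Fresh r d × Fresh r e
Fresh r (d ⊗ e)    = Fresh r d × Fresh r e
Fresh r (d ⊘ e)    = Fresh r d × Fresh r e

module ProgramLogic {c ℓ₁ ℓ₂} (K : OrderedField c ℓ₁ ℓ₂) {n : ℕ} where
  open OrderedField K hiding (zero)
  open Execution K

  infix 4 _≡off[_]_

  -- Cells are compared by `_≡_` because `_⁻¹` is not assumed to respect `_≈_`; quotients are then
  -- preserved without a look at their denominators.
  _≡off[_]_ : Memory n → ℕ → Memory n → Set c
  σ ≡off[ r ] σ₀ = ∀ r′ → r′ ≢ r → ∀ is → σ r′ is ≡ σ₀ r′ is

  off-refl : ∀ {r σ} → σ ≡off[ r ] σ
  off-refl _ _ _ = ≡.refl

  module _ {k} {ρ : Vec (Fin n) k} {r σ σ₀} (σ≡σ₀ : σ ≡off[ r ] σ₀) where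

    eval-fresh : ∀ e → Fresh r e → eval ρ σ e ≡ eval ρ σ₀ e
    eval-fresh `0 _ = ≡.refl
    eval-fresh `1 _ = ≡.refl
    eval-fresh (r′ [ xs ]) fresh = σ≡σ₀ r′ r′≢r _
      where
      r′≢r : r′ ≢ r
      r′≢r ≡.refl with r ℕ.≡ᵇ r | ℕ.≡⇒≡ᵇ r r ≡.refl
      ... | Bool.true | _ = fresh
    eval-fresh (d ⊕ e) (fd , fe) = ≡.cong₂ _+_ (eval-fresh d fd) (eval-fresh e fe)
    eval-fresh (d ⊖ e) (fd , fe) = ≡.cong₂ _-_ (eval-fresh d fd) (eval-fresh e fe)
    eval-fresh (d ⊗ e) (fd , fe) = ≡.cong₂ _*_ (eval-fresh d fd) (eval-fresh e fe)
    eval-fresh (d ⊘ e) (fd , fe) = ≡.cong₂ _/_ (eval-fresh d fd) (eval-fresh e fe)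

    Defined-fresh : ∀ e → Fresh r e → Defined ρ σ₀ e → Defined ρ σ e
    Defined-fresh `0 _ def = def
    Defined-fresh `1 _ def = def
    Defined-fresh (_ [ _ ]) _ def = def
    Defined-fresh (d ⊕ e) (fd , fe) (dd , de) = Defined-fresh d fd dd , Defined-fresh e fe de
    Defined-fresh (d ⊖ e) (fd , fe) (dd , de) = Defined-fresh d fd dd , Defined-fresh e fe de
    Defined-fresh (d ⊗ e) (fd , fe) (dd , de) = Defined-fresh d fd dd , Defined-fresh e fe de
    Defined-fresh (d ⊘ e) (fd , fe) (dd , de , e≉0) = Defined-fresh d fd dd , Defined-fresh e fe de ,
      λ e≈0 → e≉0 (trans (reflexive (≡.sym (eval-fresh e fe))) e≈0)

  write-same : ∀ r is x (σ : Memory n) → write r is x σ r is ≡ x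
  write-same r is x σ
    rewrite dec-true (r ℕ.≟ r) ≡.refl | dec-true (≡-dec Fin._≟_ is is) ≡.refl = ≡.refl

  write-off : ∀ r is x (σ : Memory n) → write r is x σ ≡off[ r ] σ
  write-off r is x σ r′ r′≢r js rewrite dec-false (r ℕ.≟ r′) (r′≢r ∘ ≡.sym) = ≡.refl

  write-other : ∀ r {is js} x (σ : Memory n) → js ≢ is → write r is x σ r js ≡ σ r js
  write-other r {is} {js} x σ js≢is
    rewrite dec-true (r ℕ.≟ r) ≡.refl | dec-false (≡-dec Fin._≟_ is js) (js≢is ∘ ≡.sym) = ≡.refl

  -- Total correctness. The step count stays existential, since `steps≤bound` bounds it for every
  -- run.
  Runs : ∀ {k p} → Vec (Fin n) k → Command k → Memory n → (Memory n → Set p) → Set (c ⊔ ℓ₁ ⊔ p)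
  Runs ρ p σ Q = ∃₂ λ τ σ′ → ρ ⊢⟨ p , σ ⟩⇓[ τ ] σ′ × Q σ′

  runs-seq : ∀ {k a b} {ρ : Vec (Fin n) k} {p q σ} {Q : Memory n → Set a} {R : Memory n → Set b} →
    Runs ρ p σ Q → (∀ {σ′} → Q σ′ → Runs ρ q σ′ R) → Runs ρ (p ⨾ q) σ R
  runs-seq (_ , _ , run , q) continue with continue q
  ... | _ , _ , run′ , r = _ , _ , seq run run′ , r

  weaken : ∀ {k a b} {ρ : Vec (Fin n) k} {p σ} {Q : Memory n → Set a} {R : Memory n → Set b} →
    Runs ρ p σ Q → (∀ {σ′} → Q σ′ → R σ′) → Runs ρ p σ R
  weaken (_ , _ , run , q) Q⇒R = _ , _ , run , Q⇒R q

  -- The invariant is indexed by the loop indices still to come. `allFin n` has no repetitions, so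
  -- the current index is not among them; elimination needs this to leave pending rows alone.
  runs-for : ∀ {k a} {ρ : Vec (Fin n) k} {p} (I : List (Fin n) → Memory n → Set a) →
    (∀ {i is σ} → i ∉ˡ is → I (i ∷ is) σ → Runs (i ∷ ρ) p σ (I is)) →
    ∀ {σ} → I (allFin n) σ → Runs ρ (for p) σ (I [])
  runs-for {ρ = ρ} {p} I step init with loop (allFin⁺ n) init
    where
    loop : ∀ {is} → Unique is → ∀ {σ} → I is σ → ∃₂ λ τ σ′ → ρ ⊢⟨for p ∈ is , σ ⟩⇓[ τ ] σ′ × I [] σ′
    loop [] inv = _ , _ , done , inv
    loop (i∉is ∷ unique) inv with step (All.All¬⇒¬Any i∉is) inv
    ... | _ , _ , run , inv′ with loop unique inv′
    ...   | _ , _ , runs , inv″ = _ , _ , next run runs , inv″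
  ... | _ , _ , run , inv = _ , _ , for run , inv

  -- p writes only to array r, and only values prescribed by v; so correct cells
  -- stay correct, and no two writes need to be kept apart.
  Fills : ∀ {k a} → Vec (Fin n) k → Command k → ℕ → (List (Fin n) → Carrier) →
    (List (Fin n) → Set a) → Memory n → Set (c ⊔ ℓ₁ ⊔ a)
  Fills ρ p r v S σ₀ = ∀ {σ} → σ ≡off[ r ] σ₀ → Runs ρ p σ λ σ′ →
    σ′ ≡off[ r ] σ₀ × (∀ {is} → σ r is ≈ v is → σ′ r is ≈ v is) × (∀ {is} → S is → σ′ r is ≈ v is)

  module _ {r : ℕ} {v : List (Fin n) → Carrier} {σ₀ : Memory n} where

    fills-write : ∀ {x is} {σ : Memory n} → σ ≡off[ r ] σ₀ → x ≈ v is →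
      write r is x σ ≡off[ r ] σ₀ × (∀ {js} → σ r js ≈ v js → write r is x σ r js ≈ v js) ×
      (∀ {js} → js ≡ is → write r is x σ r js ≈ v js)
    fills-write {x} {is} {σ} σ≡σ₀ x≈v =
      (λ r′ r′≢r js → ≡.trans (write-off r is x σ r′ r′≢r js) (σ≡σ₀ r′ r′≢r js)) , keep , written
      where
      written : ∀ {js} → js ≡ is → write r is x σ r js ≈ v js
      written ≡.refl = trans (reflexive (write-same r is x σ)) x≈v
      keep : ∀ {js} → σ r js ≈ v js → write r is x σ r js ≈ v js
      keep {js} σ≈v with ≡-dec Fin._≟_ js is
      ... | yes js≡is = written js≡is
      ... | no  js≢is = trans (reflexive (write-other r x σ js≢is)) σ≈v

    -- Since `e` does not read array `r`, its value in the initial memory `σ₀` remains its value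
    -- while `r` is being filled.
    fills-assign : ∀ {k} {ρ : Vec (Fin n) k} xs e {_ : Fresh r e} → Defined ρ σ₀ e →
      eval ρ σ₀ e ≈ v (address ρ xs) → Fills ρ (r [ xs ]≔ e) r v (_≡ address ρ xs) σ₀
    fills-assign xs e {fresh} def e≈v σ≡σ₀ = _ , _ , assign (Defined-fresh σ≡σ₀ e fresh def) ,
      fills-write σ≡σ₀ (trans (reflexive (eval-fresh σ≡σ₀ e fresh)) e≈v)

    fills-skip : ∀ {k a} {ρ : Vec (Fin n) k} {S : List (Fin n) → Set a} →
      (∀ {is} → ¬ S is) → Fills ρ skip r v S σ₀
    fills-skip ¬S σ≡σ₀ = _ , _ , skip , σ≡σ₀ , (λ σ≈v → σ≈v) , (λ s → contradiction s ¬S)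

    fills-branch : ∀ {k a} {ρ : Vec (Fin n) k} {b p q} {S : List (Fin n) → Set a} →
      (holds b ρ ≡ Bool.true → Fills ρ p r v S σ₀) →
      (holds b ρ ≡ Bool.false → Fills ρ q r v S σ₀) → Fills ρ (branch b p q) r v S σ₀
    fills-branch {ρ = ρ} {b} fp fq σ≡σ₀ with holds b ρ in eq
    ... | Bool.true  with fp ≡.refl σ≡σ₀
    ...   | _ , _ , run , post = _ , _ , ifᵗ eq run , post
    fills-branch {ρ = ρ} {b} fp fq σ≡σ₀ | Bool.false with fq ≡.refl σ≡σ₀
    ...   | _ , _ , run , post = _ , _ , ifᶠ eq run , post

    fills-for : ∀ {k a} {ρ : Vec (Fin n) k} {p} {S : Fin n → List (Fin n) → Set a} →
      (∀ i → Fills (i ∷ ρ) p r v (S i) σ₀) → Fills ρ (for p) r v (λ is → ∃ λ i → S i is) σ₀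
    fills-for {ρ = ρ} {p} {S} body σ≡σ₀ with loop (allFin n) σ≡σ₀
      where
      loop : ∀ is {σ} → σ ≡off[ r ] σ₀ → ∃₂ λ τ σ′ → ρ ⊢⟨for p ∈ is , σ ⟩⇓[ τ ] σ′ ×
        σ′ ≡off[ r ] σ₀ × (∀ {js} → σ r js ≈ v js → σ′ r js ≈ v js) ×
        (∀ {i js} → i ∈ˡ is → S i js → σ′ r js ≈ v js)
      loop []       σ≡σ₀ = _ , _ , done , σ≡σ₀ , (λ σ≈v → σ≈v) , λ ()
      loop (i ∷ is) σ≡σ₀ with body i σ≡σ₀
      ... | _ , _ , run , σ′≡σ₀ , keep , filled with loop is σ′≡σ₀
      ...   | _ , _ , runs , σ″≡σ₀ , keeps , filleds = _ , _ , next run runs , σ″≡σ₀ , keeps ∘ keep ,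
        λ { (here ≡.refl) s → keeps (filled s) ; (there i∈is) s → filleds i∈is s }
    ... | _ , _ , run , off , keep , filled = _ , _ , for run , off , keep , λ (_ , s) → filled (∈-allFin _) s

    fills-⊆ : ∀ {k a b} {ρ : Vec (Fin n) k} {p} {S : List (Fin n) → Set a} {S′ : List (Fin n) → Set b} →
      (∀ {is} → S′ is → S is) → Fills ρ p r v S σ₀ → Fills ρ p r v S′ σ₀
    fills-⊆ S′⊆S fills σ≡σ₀ with fills σ≡σ₀
    ... | _ , _ , run , off , keep , filled = _ , _ , run , off , keep , filled ∘ S′⊆S

    runs-fills : ∀ {k a} {ρ : Vec (Fin n) k} {p} {S : List (Fin n) → Set a} → Fills ρ p r v S σ₀ →
      Runs ρ p σ₀ (λ σ → σ ≡off[ r ] σ₀ × (∀ {is} → S is → σ r is ≈ v is))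
    runs-fills fills with fills off-refl
    ... | _ , _ , run , off , _ , filled = _ , _ , run , off , filled

-- The program.

-- Array 0 is the input and array 1 the output.
𝖠 𝖥 𝖤 𝖽 𝖷 𝖸 𝖷′ 𝖸′ 𝗐 : ℕ
𝖠  = 0
𝖥  = 1
𝖤  = 2
𝖽  = 3
𝖷  = 4
𝖸  = 5
𝖷′ = 6
𝖸′ = 7
𝗐  = 8

tabulate² : ∀ {k} → ℕ → Exp (2 ℕ.+ k) → Command k
tabulate² r e = for (for (r [ 1F ∷ 0F ∷ [] ]≔ e))

identity : Program
identity = for (for (branch (same 1F 0F) (𝖤 [ 1F ∷ 0F ∷ [] ]≔ `1) (𝖤 [ 1F ∷ 0F ∷ [] ]≔ `0)))

degrees : Program
degrees = for (𝖽 [ 0F ∷ [] ]≔ `0 ⨾ for (𝖽 [ 1F ∷ [] ]≔ 𝖽 [ 1F ∷ [] ] ⊕ 𝖠 [ 1F ∷ 0F ∷ [] ]))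

eliminated : ℕ → Exp 3
eliminated B = B [ 1F ∷ 0F ∷ [] ] ⊖
  B [ 1F ∷ 2F ∷ [] ] ⊗ ((𝖸′ [ 2F ∷ 0F ∷ [] ] ⊖ 𝖤 [ 2F ∷ 0F ∷ [] ]) ⊘ 𝖸′ [ 2F ∷ 2F ∷ [] ])

-- Pivot row and pivot column are read throughout the update, so the old matrices are first copied.
-- The copies also keep each expression fresh for the array it is written to.
pivoting : Command 1
pivoting = tabulate² 𝖷′ (𝖷 [ 1F ∷ 0F ∷ [] ]) ⨾
           tabulate² 𝖸′ (𝖸 [ 1F ∷ 0F ∷ [] ]) ⨾
           tabulate² 𝖷 (eliminated 𝖷′) ⨾
           tabulate² 𝖸 (eliminated 𝖸′)

-- Copying the row of the first node keeps the loop nest of assembly three deep.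
weights : Program
weights = for (branch (isFirst 0F)
  (for (𝗐 [ 0F ∷ [] ]≔ 𝖤 [ 1F ∷ 0F ∷ [] ] ⊖ 𝖸 [ 1F ∷ 0F ∷ [] ]))
  skip)

assembled : Exp 3
assembled = 𝖽 [ 1F ∷ [] ] ⊗ ((𝖷 [ 2F ∷ 1F ∷ [] ] ⊖ 𝖷 [ 0F ∷ 1F ∷ [] ]) ⊖
  𝗐 [ 1F ∷ [] ] ⊘ 𝗐 [ 0F ∷ [] ] ⊗ (𝖷 [ 2F ∷ 0F ∷ [] ] ⊖ 𝖷 [ 0F ∷ 0F ∷ [] ]))

assembly : Program
assembly = for (for (for (𝖥 [ 2F ∷ 1F ∷ 0F ∷ [] ]≔ assembled)))

program : Program
program = identity ⨾
          degrees ⨾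
          tabulate² 𝖷 (𝖤 [ 1F ∷ 0F ∷ [] ]) ⨾
          tabulate² 𝖸 (𝖽 [ 1F ∷ [] ] ⊗ 𝖤 [ 1F ∷ 0F ∷ [] ] ⊖ 𝖠 [ 1F ∷ 0F ∷ [] ]) ⨾
          for (branch (isFirst 0F) skip pivoting) ⨾
          weights ⨾
          assembly

-- Correctness of the program.

module Correctness {c ℓ₁ ℓ₂} (K : OrderedField c ℓ₁ ℓ₂) where
  open OrderedField K hiding (zero)
  open OrderedFieldProperties K
  open RandomWalks K
  open LinearAlgebra K
  open NetworkProperties K
  open FundamentalTensors K
  open Elimination K
  open Execution K
  open ProgramLogic K

  -- At nonzero arguments congruence follows from the uniqueness of inverses. It is applied to the
  -- pivots and the weights.
  ⁻¹-cong : ∀ {x y} → ¬ y ≈ 0# → x ≈ y → x ⁻¹ ≈ y ⁻¹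
  ⁻¹-cong y≉0 x≈y = *-cancelˡ y≉0
    (trans (trans (*-congʳ (sym x≈y)) (⁻¹-inverseʳ (y≉0 ∘ trans (sym x≈y)))) (sym (⁻¹-inverseʳ y≉0)))

  module _ {n : ℕ} where

    record Holds₁ (σ : Memory n) (r : ℕ) (x : Vector n) : Set ℓ₁ where
      constructor contains
      field entry₁ : ∀ i → σ r (i ∷ []) ≈ x i

    record Holds₂ (σ : Memory n) (r : ℕ) (M : Matrix {n}) : Set ℓ₁ where
      constructor contains
      field entry₂ : ∀ i j → σ r (i ∷ j ∷ []) ≈ M i j

    open Holds₁ public
    open Holds₂ public

    keep₁ : ∀ {σ′ σ r r′ x} → σ′ ≡off[ r ] σ → {_ : Bool.T (Bool.not (r′ ℕ.≡ᵇ r))} → Holds₁ σ r′ x → Holds₁ σ′ r′ x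
    keep₁ {r = r} {r′} off {fresh} (contains x≈) = contains λ i →
      trans (reflexive (eval-fresh {ρ = i ∷ []} off (r′ [ 0F ∷ [] ]) fresh)) (x≈ i)

    keep₂ : ∀ {σ′ σ r r′ M} → σ′ ≡off[ r ] σ → {_ : Bool.T (Bool.not (r′ ℕ.≡ᵇ r))} → Holds₂ σ r′ M → Holds₂ σ′ r′ M
    keep₂ {r = r} {r′} off {fresh} (contains M≈) = contains λ i j →
      trans (reflexive (eval-fresh {ρ = i ∷ j ∷ []} off (r′ [ 0F ∷ 1F ∷ [] ]) fresh)) (M≈ i j)

    contents₁ : Vector n → List (Fin n) → Carrier
    contents₁ x (i ∷ []) = x i
    contents₁ x _        = 0#

    contents₂ : Matrix {n} → List (Fin n) → Carrier
    contents₂ M (i ∷ j ∷ []) = M i j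
    contents₂ M _            = 0#

    contents₃ : Tensor n → List (Fin n) → Carrier
    contents₃ 𝐅 (i ∷ j ∷ k ∷ []) = 𝐅 i j k
    contents₃ 𝐅 _                = 0#

    runs-tabulate² : ∀ {k} {ρ : Vec (Fin n) k} r e {_ : Fresh r e} (M : Matrix {n}) {σ} →
      (∀ i j → Defined (j ∷ i ∷ ρ) σ e) → (∀ i j → eval (j ∷ i ∷ ρ) σ e ≈ M i j) →
      Runs ρ (tabulate² r e) σ (λ σ′ → σ′ ≡off[ r ] σ × Holds₂ σ′ r M)
    runs-tabulate² {ρ = ρ} r e {fresh} M {σ} def e≈M =
      weaken (runs-fills fills) (λ (off , filled) → off , contains λ i j → filled (i , j , ≡.refl))
      where
      fills : Fills ρ (tabulate² r e) r (contents₂ M) (λ is → ∃₂ λ i j → is ≡ i ∷ j ∷ []) σ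
      fills = fills-for (λ i → fills-for (λ j → fills-assign _ e {fresh} (def i j) (e≈M i j)))

    runs-identity : ∀ {σ} → Runs [] identity σ (λ σ′ → σ′ ≡off[ 𝖤 ] σ × Holds₂ σ′ 𝖤 1ᴹ)
    runs-identity {σ} =
      weaken (runs-fills fills) (λ (off , filled) → off , contains λ i j → filled (i , j , ≡.refl))
      where
      cell : ∀ i j → Fills (j ∷ i ∷ []) _ 𝖤 (contents₂ 1ᴹ) (_≡ i ∷ j ∷ []) σ
      cell i j = fills-branch
        (λ eq → fills-assign _ `1 (lift tt) (reflexive (≡.cong (Bool.if_then 1# else 0#) (≡.sym eq))))
        (λ eq → fills-assign _ `0 (lift tt) (reflexive (≡.cong (Bool.if_then 1# else 0#) (≡.sym eq))))
      fills : Fills [] identity 𝖤 (contents₂ 1ᴹ) (λ is → ∃₂ λ i j → is ≡ i ∷ j ∷ []) σ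
      fills = fills-for (λ i → fills-for (cell i))

    private
      foldr-tabulate : ∀ {m} (f : Fin n → Carrier) (g : Fin m → Fin n) →
        List.foldr (λ j s → f j + s) 0# (List.tabulate g) ≡ sum (f ∘ g)
      foldr-tabulate {zero}  f g = ≡.refl
      foldr-tabulate {suc m} f g = ≡.cong (f (g zero) +_) (foldr-tabulate f (g ∘ suc))

    runs-degrees : ∀ {σ a} → Holds₂ σ 𝖠 a →
      Runs [] degrees σ (λ σ′ → σ′ ≡off[ 𝖽 ] σ × Holds₁ σ′ 𝖽 (λ i → sum (a i)))
    runs-degrees {σ₀} {a} holds-a =
      weaken (runs-fills fills) (λ (off , filled) → off , contains λ i → filled (i , ≡.refl))
      where
      d : Vector n
      d i = sum (a i)
      -- A degree cell holds partial sums until its row is finished, so the rule that every write is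
      -- already correct does not apply to this inner loop; it is traced directly.
      accumulate : ∀ i is {σ} → σ ≡off[ 𝖽 ] σ₀ →
        ∃₂ λ τ σ′ → (i ∷ []) ⊢⟨for (𝖽 [ 1F ∷ [] ]≔ 𝖽 [ 1F ∷ [] ] ⊕ 𝖠 [ 1F ∷ 0F ∷ [] ]) ∈ is , σ ⟩⇓[ τ ] σ′ ×
          σ′ ≡off[ 𝖽 ] σ₀ × (∀ {js} → js ≢ i ∷ [] → σ′ 𝖽 js ≡ σ 𝖽 js) ×
          σ′ 𝖽 (i ∷ []) ≈ σ 𝖽 (i ∷ []) + List.foldr (λ j s → a i j + s) 0# is
      accumulate i [] off = _ , _ , done , off , (λ _ → ≡.refl) , sym (+-identityʳ _)
      accumulate i (j ∷ is) {σ} off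
        with accumulate i is {write 𝖽 (i ∷ []) (σ 𝖽 (i ∷ []) + σ 𝖠 (i ∷ j ∷ [])) σ}
               (λ r r≢𝖽 js → ≡.trans (write-off 𝖽 (i ∷ []) _ σ r r≢𝖽 js) (off r r≢𝖽 js))
      ... | _ , _ , runs , off′ , unchanged , value = _ , _ , next (assign (lift tt , lift tt)) runs , off′ ,
        (λ js≢ → ≡.trans (unchanged js≢) (write-other 𝖽 _ σ js≢)) ,
        trans value (trans (+-congʳ (trans (reflexive (write-same 𝖽 (i ∷ []) _ σ))
          (+-congˡ (trans (reflexive (off 𝖠 (λ ()) _)) (entry₂ holds-a i j))))) (+-assoc _ _ _))
      row : ∀ i → Fills (i ∷ []) _ 𝖽 (contents₁ d) (_≡ i ∷ []) σ₀
      row i {σ} off with accumulate i (allFin n) {write 𝖽 (i ∷ []) 0# σ}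
                           (λ r r≢𝖽 js → ≡.trans (write-off 𝖽 (i ∷ []) _ σ r r≢𝖽 js) (off r r≢𝖽 js))
      ... | _ , σ′ , runs , off′ , unchanged , value =
        _ , _ , seq (assign (lift tt)) (for runs) , off′ , keep , filled
        where
        filled : ∀ {is} → is ≡ i ∷ [] → σ′ 𝖽 is ≈ contents₁ d is
        filled ≡.refl = trans value (trans (+-congʳ (reflexive (write-same 𝖽 (i ∷ []) _ σ)))
          (trans (+-identityˡ _) (reflexive (foldr-tabulate (a i) (λ j → j)))))
        keep : ∀ {is} → σ 𝖽 is ≈ contents₁ d is → σ′ 𝖽 is ≈ contents₁ d is
        keep {is} correct with ≡-dec Fin._≟_ is (i ∷ [])
        ... | yes is≡ = filled is≡
        ... | no  is≢ = trans (reflexive (≡.trans (unchanged is≢) (write-other 𝖽 _ σ is≢))) correct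
      fills : Fills [] degrees 𝖽 (contents₁ d) (λ is → ∃ λ i → is ≡ i ∷ []) σ₀
      fills = fills-for row

  module _ {m : ℕ} (G : Network (suc m)) (connected : StronglyConnected G) where
    open Network G

    record Progress (rest : List (Fin (suc m))) (σ : Memory (suc m)) : Set (c ⊔ ℓ₁) where
      field
        {X Y}   : Matrix
        reduced : Reduced G connected zero rest X Y
        holds-𝖤 : Holds₂ σ 𝖤 1ᴹ
        holds-𝖽 : Holds₁ σ 𝖽 degree
        holds-𝖷 : Holds₂ σ 𝖷 X
        holds-𝖸 : Holds₂ σ 𝖸 Y

    private
      eliminated≈ : ∀ {σ : Memory (suc m)} {B Y M} p → ¬ Y p p ≈ 0# → Holds₂ σ 𝖤 1ᴹ → Holds₂ σ 𝖸′ Y → Holds₂ σ B M →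
        ∀ i j → eval (j ∷ i ∷ p ∷ []) σ (eliminated B) ≈ eliminate p Y M i j
      eliminated≈ p Yₚₚ≉0 holds-𝖤 holds-𝖸′ holds-B i j =
        +-cong (entry₂ holds-B i j) (-‿cong (*-cong (entry₂ holds-B i p)
          (*-cong (+-cong (entry₂ holds-𝖸′ p j) (-‿cong (entry₂ holds-𝖤 p j)))
                  (⁻¹-cong Yₚₚ≉0 (entry₂ holds-𝖸′ p p)))))

      eliminated-defined : ∀ {σ : Memory (suc m)} {B Y} p → ¬ Y p p ≈ 0# → Holds₂ σ 𝖸′ Y →
        ∀ i j → Defined (j ∷ i ∷ p ∷ []) σ (eliminated B)
      eliminated-defined p Yₚₚ≉0 holds-𝖸′ i j =
        _ , _ , (_ , _) , _ , Yₚₚ≉0 ∘ trans (sym (entry₂ holds-𝖸′ p p))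

      runs-pivoting : ∀ {p rest σ} → p ≢ zero → p ∉ˡ rest → Progress (p ∷ rest) σ →
        Runs (p ∷ []) pivoting σ (Progress rest)
      runs-pivoting {p} {rest} p≢0 p∉rest progress =
        runs-seq (runs-tabulate² 𝖷′ _ X (λ _ _ → _) (entry₂ holds-𝖷)) λ (off₁ , holds-𝖷′) →
        runs-seq (runs-tabulate² 𝖸′ _ Y (λ _ _ → _) (entry₂ (keep₂ off₁ holds-𝖸))) λ (off₂ , holds-𝖸′) →
        let holds-𝖤₂ = keep₂ off₂ (keep₂ off₁ holds-𝖤) in
        runs-seq (runs-tabulate² 𝖷 (eliminated 𝖷′) (eliminate p Y X)
          (eliminated-defined {B = 𝖷′} p Yₚₚ≉0 holds-𝖸′)
          (eliminated≈ p Yₚₚ≉0 holds-𝖤₂ holds-𝖸′ (keep₂ off₂ holds-𝖷′))) λ (off₃ , holds-𝖷₃) →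
        let holds-𝖤₃  = keep₂ off₃ holds-𝖤₂
            holds-𝖸′₃ = keep₂ off₃ holds-𝖸′ in
        weaken (runs-tabulate² 𝖸 (eliminated 𝖸′) (eliminate p Y Y)
          (eliminated-defined {B = 𝖸′} p Yₚₚ≉0 holds-𝖸′₃)
          (eliminated≈ p Yₚₚ≉0 holds-𝖤₃ holds-𝖸′₃ holds-𝖸′₃)) λ (off₄ , holds-𝖸₄) → record
            { reduced = reduced-eliminate G connected zero reduced p≢0 p∉rest
            ; holds-𝖤 = keep₂ off₄ holds-𝖤₃
            ; holds-𝖽 = keep₁ off₄ (keep₁ off₃ (keep₁ off₂ (keep₁ off₁ holds-𝖽)))
            ; holds-𝖷 = keep₂ off₄ holds-𝖷₃
            ; holds-𝖸 = holds-𝖸₄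
            }
        where
        open Progress progress
        Yₚₚ≉0 : ¬ Y p p ≈ 0#
        Yₚₚ≉0 = pivot≉0 G connected zero reduced p≢0

    runs-elimination : ∀ {σ} → Progress (allFin (suc m)) σ →
      Runs [] (for (branch (isFirst 0F) skip pivoting)) σ (Progress [])
    runs-elimination = runs-for Progress step
      where
      step : ∀ {p rest σ} → p ∉ˡ rest → Progress (p ∷ rest) σ →
        Runs (p ∷ []) (branch (isFirst 0F) skip pivoting) σ (Progress rest)
      step {zero} _ progress = _ , _ , ifᵗ ≡.refl skip , record
        { reduced = reduced-skip G connected zero reduced
        ; holds-𝖤 = holds-𝖤
        ; holds-𝖽 = holds-𝖽
        ; holds-𝖷 = holds-𝖷
        ; holds-𝖸 = holds-𝖸
        } where open Progress progress
      step {suc p} p∉rest progress =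
        let _ , _ , run , progress′ = runs-pivoting (λ ()) p∉rest progress in
        _ , _ , ifᶠ ≡.refl run , progress′

    module _ {σ} (progress : Progress [] σ) where
      open Progress progress

      private
        w = weight G connected zero reduced

      runs-weights : Runs [] weights σ (λ σ′ → σ′ ≡off[ 𝗐 ] σ × Holds₁ σ′ 𝗐 w)
      runs-weights =
        weaken (runs-fills fills) (λ (off , filled) → off , contains λ i → filled (zero , ≡.refl , i , ≡.refl))
        where
        -- Only the iteration at the root writes; the condition `r ≡ zero` makes the claim of every
        -- other iteration empty.
        row : ∀ r → Fills (r ∷ []) _ 𝗐 (contents₁ w) (λ is → r ≡ zero × ∃ λ j → is ≡ j ∷ []) σ
        row zero = fills-branch
          (λ _ → fills-⊆ proj₂ (fills-for (λ j → fills-assign _ _ _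
            (+-cong (entry₂ holds-𝖤 zero j) (-‿cong (entry₂ holds-𝖸 zero j))))))
          (λ ())
        row (suc r) = fills-branch (λ ()) (λ _ → fills-skip λ { (() , _) })
        fills : Fills [] weights 𝗐 (contents₁ w) (λ is → ∃ λ r → r ≡ zero × ∃ λ j → is ≡ j ∷ []) σ
        fills = fills-for row

      runs-assembly : ∀ {σ′} → σ′ ≡off[ 𝗐 ] σ → Holds₁ σ′ 𝗐 w →
        Runs [] assembly σ′ (λ σ″ → ∀ s m t → output σ″ s m t ≈ green G connected zero reduced s m t)
      runs-assembly {σ′} off holds-𝗐 =
        weaken (runs-fills fills) (λ (_ , filled) s m t → filled (s , m , t , ≡.refl))
        where
        cell : ∀ s m t → Fills (t ∷ m ∷ s ∷ []) (𝖥 [ 2F ∷ 1F ∷ 0F ∷ [] ]≔ assembled) 𝖥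
          (contents₃ (green G connected zero reduced)) (_≡ s ∷ m ∷ t ∷ []) σ′
        cell s m t = fills-assign (2F ∷ 1F ∷ 0F ∷ []) assembled
          (_ , (_ , _) , (_ , _ , weight≉0 G connected zero reduced t ∘ trans (sym (entry₁ holds-𝗐 t))) , _ , _)
          (*-cong (entry₁ (keep₁ off holds-𝖽) m)
            (+-cong (+-cong (𝖷≈ s m) (-‿cong (𝖷≈ t m)))
              (-‿cong (*-cong (*-cong (entry₁ holds-𝗐 m)
                                      (⁻¹-cong (weight≉0 G connected zero reduced t) (entry₁ holds-𝗐 t)))
                (+-cong (𝖷≈ s t) (-‿cong (𝖷≈ t t)))))))
          where
          𝖷≈ : ∀ i j → σ′ 𝖷 (i ∷ j ∷ []) ≈ X i j
          𝖷≈ = entry₂ (keep₂ off holds-𝖷)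
        fills : Fills [] assembly 𝖥 (contents₃ (green G connected zero reduced))
                  (λ is → ∃ λ s → ∃₂ λ m t → is ≡ s ∷ m ∷ t ∷ []) σ′
        fills = fills-for (λ s → fills-for (λ m → fills-for (cell s m)))

    runs-program⁺ : Runs [] program (load affinity) (λ σ → IsFundamentalTensor G (output σ))
    runs-program⁺ =
      runs-seq runs-identity λ (off₁ , holds-𝖤) →
      let holds-𝖠 = keep₂ {M = affinity} off₁ (contains λ _ _ → refl) in
      runs-seq (runs-degrees holds-𝖠) λ (off₂ , holds-𝖽) →
      let holds-𝖤₂ = keep₂ off₂ holds-𝖤 in
      runs-seq (runs-tabulate² 𝖷 _ 1ᴹ (λ _ _ → _) (entry₂ holds-𝖤₂)) λ (off₃ , holds-𝖷) →
      let holds-𝖤₃ = keep₂ off₃ holds-𝖤₂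
          holds-𝖽₃ = keep₁ off₃ holds-𝖽 in
      runs-seq (runs-tabulate² 𝖸 _ (graphLaplacian G) (λ _ _ → _)
        (λ i j → +-cong (trans (*-cong (entry₁ holds-𝖽₃ i) (entry₂ holds-𝖤₃ i j)) (sym (diag≈*δ degree i j)))
                        (-‿cong (entry₂ (keep₂ off₃ (keep₂ off₂ holds-𝖠)) i j)))) λ (off₄ , holds-𝖸) →
      runs-seq (runs-elimination record
        { reduced = reduced-initial G connected zero
        ; holds-𝖤 = keep₂ off₄ holds-𝖤₃
        ; holds-𝖽 = keep₁ off₄ holds-𝖽₃
        ; holds-𝖷 = keep₂ off₄ holds-𝖷
        ; holds-𝖸 = holds-𝖸
        }) λ progress →
      runs-seq (runs-weights progress) λ (off , holds-𝗐) →
      weaken (runs-assembly progress off holds-𝗐) λ output≈green →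
        fundamental-cong G output≈green (green⇒fundamental G connected
          (green-isGreenTensor G connected zero (Progress.reduced progress)))

  runs-program : ∀ {n} (G : Network n) → StronglyConnected G →
    Runs [] program (load (Network.affinity G)) (λ σ → IsFundamentalTensor G (output σ))
  -- Without nodes there is no root to choose; all seven loops are empty and so is the tensor.
  runs-program {zero} G connected = _ , _ ,
    seq (for done) (seq (for done) (seq (for done) (seq (for done) (seq (for done) (seq (for done) (for done)))))) ,
    green⇒fundamental G connected record { from-target = λ () ; at-target = λ () ; inverse = λ { {()} } }
  runs-program {suc m} G connected = runs-program⁺ G connected

theorem1 :
  ∀ {c ℓ₁ ℓ₂} (K : OrderedField c ℓ₁ ℓ₂) →
  let open OrderedField K
      open RandomWalks K
      open Execution K
  in
  (∀ {n} (G : Network n) → StronglyConnected G →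
   ∀ (π : Fin n → Carrier) → IsStationary G π →
     (∀ i → 0# < π i) ×
     (∀ (𝐅 : Tensor n) → IsFundamentalTensor G 𝐅 →
       (∀ (L⁺ : Matrix) → IsMoorePenrose (digraphLaplacian G π) L⁺ →
        ∀ s m t → 𝐅 s m t ≈ (L⁺ s m - L⁺ t m + L⁺ t t - L⁺ s t) * π m) ×
       (∀ (Lᵖ⁺ : Matrix) → IsMoorePenrose (randomWalkLaplacian G) Lᵖ⁺ →
        ∀ s m t → 𝐅 s m t ≈ Lᵖ⁺ s m - Lᵖ⁺ t m + (π m / π t) * Lᵖ⁺ t t - (π m / π t) * Lᵖ⁺ s t)))
  ×
  (Σ Program λ p → Σ (ℕ → ℕ) λ T → T ∈O (λ n → n ℕ.^ 3) ×
    (∀ {n} (G : Network n) → StronglyConnected G →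
     ∃₂ λ τ σ →
       [] ⊢⟨ p , load (Network.affinity G) ⟩⇓[ τ ] σ ×
       τ ℕ.≤ T n ×
       IsFundamentalTensor G (output σ)))
theorem1 K =
  (λ G connected π stationary → stationary-pos G stationary connected , λ 𝐅 fundamental →
    let green = fundamental⇒green G fundamental in
    (λ L⁺ → digraphLaplacian-formula connected stationary green) ,
    (λ Lᵖ⁺ → randomWalkLaplacian-formula connected stationary green)) ,
  -- The loops of `program` nest at most three deep, so `depth program` computes to 3 and `bound` is
  -- this power by definition.
  program , (λ n → bound n program) , shifted-power-∈O (coefficient program) 3 ,
  λ G connected → let τ , σ , run , fundamental = runs-program G connected in
    τ , σ , run , steps≤bound run , fundamental
  where
  open FundamentalTensors K
  open LaplacianFormulas K
  open Cost K
  open Correctness K
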